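{- For every constant $L$ there is a polynomial-time algorithm and a function $\varepsilon:\mathbb{N}\to\mathbb{R}_{\ge 0}$ with $\varepsilon(d)\to 0$ as $d\to\infty$ such that, given any finite connected graph $G$ of diameter $d$ and path-length at most $L$, the algorithm outputs a burning schedule that burns all vertices of $G$ within at most $(1+\varepsilon(d))\, bn(G)$ rounds. (That is, for graphs of bounded path-length there is an algorithm with approximation factor $1+o(1)$.)
   Context: Graphs are finite, simple, undirected and unweighted; $d(u,v)$ denotes the shortest-path distance. Burning process: it takes place in synchronous rounds $1,2,\dots$. In each round $i$, every vertex having a neighbour that was burned in an earlier round becomes burned, and additionally one chosen vertex $a_i$ (the activator of round $i$) becomes burned; burned vertices stay burned. A burning schedule $\langle a_1,\dots,a_m\rangle$ burns $G$ in $m$ rounds if all vertices are burned by the end of round $m$, equivalently every vertex $v$ satisfies $d(v,a_i)\le m-i$ for some $i\in\{1,\dots,m\}$. The burning number $bn(G)$ is the minimum $m$ for which a burning schedule burning $G$ in $m$ rounds exists. A path decomposition of $G$ is a path whose nodes are finitely many bags, each bag being a subset of the vertices of $G$, such that every edge $\{v,w\}$ of $G$ has both endpoints in some common bag, and for every vertex $v$ of $G$ the bags containing $v$ form a (nonempty) connected subpath. The length of a decomposition is the maximum of $d(x,y)$ (distance in $G$) over all pairs $x,y$ lying in a common bag; the path-length of $G$ is the minimum length over all its path decompositions. -}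

module Defs where

open import Data.Bool.Base using (Bool; true; false; T; if_then_else_)
open import Data.Fin.Base as Fin using (Fin; toℕ; fromℕ<; remQuot)
open import Data.Fin.Subset using (Subset; _∈_)
open import Data.Integer.Base using (+_)
open import Data.Nat.Base using (ℕ; suc; _+_; _*_; _∸_; _^_; _≤_; _≡ᵇ_)
open import Data.Nat.Properties using (_<?_)
open import Data.Product.Base using (Σ-syntax; ∃; ∃-syntax; _×_; _,_; uncurry)
open import Data.Rational.Base as ℚ using (ℚ; 0ℚ)
open import Data.Vec.Functional using (Vector)
open import Relation.Binary.PropositionalEquality.Core using (_≡_; _≢_)
open import Relation.Nullary.Decidable.Core using (yes; no)

IsMinimum : (ℕ → Set) → ℕ → Set
IsMinimum P m = P m × (∀ k → P k → m ≤ k)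

IsMaximum : (ℕ → Set) → ℕ → Set
IsMaximum P m = P m × (∀ k → P k → k ≤ m)

record Graph : Set where
  field
    order : ℕ
    adj   : Fin order → Fin order → Bool
    sym   : ∀ u v → adj u v ≡ adj v u
    irr   : ∀ v → adj v v ≡ false

  Vertex : Set
  Vertex = Fin order

  Adj : Vertex → Vertex → Set
  Adj u v = T (adj u v)

open Graph public using (order; adj; Vertex; Adj)

data Walk (G : Graph) : ℕ → Vertex G → Vertex G → Set where
  []  : ∀ {v} → Walk G 0 v v
  _∷_ : ∀ {k u v w} → Adj G u v → Walk G k v w → Walk G (suc k) u w

Connected : Graph → Set
Connected G = ∀ u v → ∃[ k ] Walk G k u v

-- Distance G u v k says d(u,v) = k.
Distance : (G : Graph) → Vertex G → Vertex G → ℕ → Set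
Distance G u v = IsMinimum (λ k → Walk G k u v)

-- No d satisfies IsDiameter for the graph without vertices.
IsDiameter : Graph → ℕ → Set
IsDiameter G = IsMaximum (λ k → ∃[ u ] ∃[ v ] Distance G u v k)

Schedule : Graph → ℕ → Set
Schedule G m = Vector (Vertex G) m

-- Burned G a r v says that v is burned by the end of round r. Rounds are
-- numbered from 1, so a i (with toℕ i counting from 0) is the activator of
-- round suc (toℕ i).
data Burned (G : Graph) {m : ℕ} (a : Schedule G m) : ℕ → Vertex G → Set where
  activate : ∀ i → Burned G a (suc (toℕ i)) (a i)
  spread   : ∀ {r u v} → Burned G a r u → Adj G u v → Burned G a (suc r) v
  stay     : ∀ {r v} → Burned G a r v → Burned G a (suc r) v

Burns : (G : Graph) {m : ℕ} → Schedule G m → Set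
Burns G {m} a = ∀ v → Burned G a m v

IsBurningNumber : Graph → ℕ → Set
IsBurningNumber G = IsMinimum (λ m → Σ[ a ∈ Schedule G m ] Burns G a)

record PathDecomposition (G : Graph) : Set where
  field
    size       : ℕ
    bag        : Fin size → Subset (order G)
    edges      : ∀ u v → Adj G u v → ∃[ i ] (u ∈ bag i × v ∈ bag i)
    nonempty   : ∀ v → ∃[ i ] v ∈ bag i
    contiguous : ∀ v i j k → i Fin.≤ j → j Fin.≤ k →
                 v ∈ bag i → v ∈ bag k → v ∈ bag j

HasLength : (G : Graph) → PathDecomposition G → ℕ → Set
HasLength G D = IsMaximum λ k →
  ∃[ i ] ∃[ x ] ∃[ y ] (x ∈ bag i × y ∈ bag i × Distance G x y k)
  where open PathDecomposition D

IsPathLength : Graph → ℕ → Set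
IsPathLength G = IsMinimum (λ ℓ → ∃[ D ] HasLength G D ℓ)

-- Algorithms are structured programs for a random access machine.
--
-- The machine has scalar variables and unbounded arrays of natural numbers,
-- both named by numerals; a program mentions only finitely many of them.
-- Every operation costs one unit. There is deliberately no multiplication: with
-- addition and truncated subtraction alone, numbers have O(t) more bits than
-- the input after t steps, which makes polynomial time for this machine agree
-- with polynomial time for Turing machines.

data Expr : Set where
  lit  : ℕ → Expr
  var  : ℕ → Expr
  read : ℕ → Expr → Expr          -- read x e is the entry of array x at e
  _⊕_  : Expr → Expr → Expr
  _⊖_  : Expr → Expr → Expr

infixl 6 _⊕_ _⊖_

data Program : Set where
  skip   : Program
  assign : ℕ → Expr → Program
  write  : ℕ → Expr → Expr → Program   -- write x e f sets entry e of array x to f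
  _⨾_    : Program → Program → Program
  cond   : Expr → Program → Program → Program
  while  : Expr → Program → Program

infixr 4 _⨾_

record State : Set where
  constructor ⟨_,_⟩
  field
    scalar : ℕ → ℕ
    array  : ℕ → ℕ → ℕ

open State public

_[_↦_] : {A : Set} → (ℕ → A) → ℕ → A → (ℕ → A)
(f [ x ↦ a ]) y = if x ≡ᵇ y then a else f y

⟦_⟧ : Expr → State → ℕ
⟦ lit n ⟧    s = n
⟦ var x ⟧    s = scalar s x
⟦ read x e ⟧ s = array s x (⟦ e ⟧ s)
⟦ e ⊕ f ⟧    s = ⟦ e ⟧ s + ⟦ f ⟧ s
⟦ e ⊖ f ⟧    s = ⟦ e ⟧ s ∸ ⟦ f ⟧ s

cost : Expr → ℕ
cost (lit n)    = 1
cost (var x)    = 1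
cost (read x e) = suc (cost e)
cost (e ⊕ f)    = suc (cost e + cost f)
cost (e ⊖ f)    = suc (cost e + cost f)

-- s ⊢ p ⇓[ t ] s′ says that p, started in s, halts in s′ after t steps. In
-- tests, zero is false and every other number is true.
data _⊢_⇓[_]_ : State → Program → ℕ → State → Set where
  ⇓skip   : ∀ {s} → s ⊢ skip ⇓[ 1 ] s
  ⇓assign : ∀ {s x e} →
            s ⊢ assign x e ⇓[ suc (cost e) ]
              ⟨ scalar s [ x ↦ ⟦ e ⟧ s ] , array s ⟩
  ⇓write  : ∀ {s x e f} →
            s ⊢ write x e f ⇓[ suc (cost e + cost f) ]
              ⟨ scalar s , array s [ x ↦ array s x [ ⟦ e ⟧ s ↦ ⟦ f ⟧ s ] ] ⟩
  ⇓seq    : ∀ {s s′ s″ p q t t′} →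
            s ⊢ p ⇓[ t ] s′ → s′ ⊢ q ⇓[ t′ ] s″ →
            s ⊢ p ⨾ q ⇓[ t + t′ ] s″
  ⇓true   : ∀ {s s′ e p q t} → ⟦ e ⟧ s ≢ 0 →
            s ⊢ p ⇓[ t ] s′ →
            s ⊢ cond e p q ⇓[ suc (cost e + t) ] s′
  ⇓false  : ∀ {s s′ e p q t} → ⟦ e ⟧ s ≡ 0 →
            s ⊢ q ⇓[ t ] s′ →
            s ⊢ cond e p q ⇓[ suc (cost e + t) ] s′
  ⇓loop   : ∀ {s s′ s″ e p t t′} → ⟦ e ⟧ s ≢ 0 →
            s ⊢ p ⇓[ t ] s′ → s′ ⊢ while e p ⇓[ t′ ] s″ →
            s ⊢ while e p ⇓[ suc (cost e + (t + t′)) ] s″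
  ⇓exit   : ∀ {s e p} → ⟦ e ⟧ s ≡ 0 →
            s ⊢ while e p ⇓[ suc (cost e) ] s

-- Row-major adjacency matrix: entry i * n + j tells whether i and j are
-- adjacent; entries beyond the matrix are zero.
matrix : Graph → ℕ → ℕ
matrix G p with p <? order G * order G
... | yes p<n² = if uncurry (adj G) (remQuot (order G) (fromℕ< p<n²)) then 1 else 0
... | no _     = 0

-- The order is in variable 0 and the adjacency matrix in array 0; everything
-- else is zero.
input : Graph → State
input G = ⟨ (λ _ → 0) [ 0 ↦ order G ] , (λ _ _ → 0) [ 0 ↦ matrix G ] ⟩

inputSize : Graph → ℕ
inputSize G = suc (order G * order G)

PolynomialTime : Program → Set
PolynomialTime p = ∃[ c ] ∃[ k ] (∀ G → ∃[ t ] ∃[ s ]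
  (input G ⊢ p ⇓[ t ] s × t ≤ c * inputSize G ^ k))

-- A schedule is output as its number of rounds in variable 0 and its
-- activators, in order, at the start of array 0.
Outputs : Program → (G : Graph) {m : ℕ} → Schedule G m → Set
Outputs p G {m} a = ∃[ t ] ∃[ s ] (input G ⊢ p ⇓[ t ] s ×
  scalar s 0 ≡ m × (∀ i → array s 0 (toℕ i) ≡ toℕ (a i)))

fromℕ : ℕ → ℚ
fromℕ n = + n ℚ./ 1

TendsToZero : (ℕ → ℚ) → Set
TendsToZero ε = ∀ δ → 0ℚ ℚ.< δ → ∃[ N ] (∀ d → N ≤ d → ℚ.∣ ε d ∣ ℚ.< δ)

{-# OPTIONS --safe #-}
module Submission where

-- A shortest path between the two end bags of a path decomposition of length L
-- meets every bag, so the graph is a path up to an error O(L). A vertex u farthest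
-- from an arbitrary vertex lies near one of the ends, and therefore
-- d(w,z) ≤ |d(w,u) − d(z,u)| + 4L for all w and z. Hence it suffices to burn the
-- levels of the distance to u as if they were a path, with 4L extra rounds: for
-- ρ = 0, 1, …, an activator with ρ rounds left on the level ρ² + ρ burns the levels
-- ρ², …, ρ² + 2ρ. If E is the eccentricity of u, this takes ⌊√E⌋ + 1 + 4L rounds.
-- Conversely, b rounds burn at most b² vertices of a shortest path, so b > ⌊√d⌋
-- for the diameter d ≥ E, and ε(d) = 4L / (⌊√d⌋ + 1) will do.

open import Defs
open import Data.Bool.Base using (true; false; T; not; if_then_else_)
open import Data.Bool.Properties using (T?)
open import Data.Fin.Base as Fin using (Fin; toℕ; fromℕ<; combine; remQuot)
open import Data.Fin.Properties as Fin
  using (any?; combine-injective; fromℕ<-injective; injective⇒≤; remQuot-combine;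
         toℕ-combine; toℕ-fromℕ<; toℕ-injective; toℕ<n)
open import Data.Fin.Subset using (_∈_)
import Data.Integer.Base as ℤ
import Data.Integer.Properties as ℤ
open import Data.Nat.Base
open import Data.Nat.Properties
open import Data.Nat.Tactic.RingSolver using (solve-∀)
open import Data.Product.Base using (Σ-syntax; ∃-syntax; _×_; _,_; proj₁; proj₂; uncurry)
open import Data.Rational.Base as ℚ using (ℚ; 0ℚ; 1ℚ; mkℚ)
import Data.Rational.Properties as ℚ
open import Data.Rational.Unnormalised.Base as ℚᵘ using (mkℚᵘ)
import Data.Rational.Unnormalised.Properties as ℚᵘ
open import Data.Sum.Base using (_⊎_; inj₁; inj₂)
open import Function.Base using (_∘_; flip)
open import Relation.Binary.Definitions using (Total)
open import Relation.Binary.PropositionalEquality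
open import Relation.Nullary using (Dec; yes; no; contradiction)
open import Relation.Nullary.Decidable using (map′; _×-dec_)
open import Relation.Unary using (Decidable)

-- Integer square roots

-- The decomposition is never computed. It occurs only in the analysis, and the program knows
-- nothing of it but the number `4 * L`: distances to the one vertex `u` already act as positions
-- along the path. A search from vertex 0 finds `u`, and a second search, from `u`, yields the
-- levels and `E`. The extra rounds come last in the schedule, so they extend the reach of every
-- earlier activator by 4L, which absorbs the error of the path model. The other obstacle is the
-- machine, whose semantics is a relation with step counts. The program is therefore written with
-- counted loops only. These have a total semantics `run`, about which correctness is proved, and
-- `halts` transfers the result to the machine together with a time bound. As the machine cannot
-- multiply, matrix indices and squares are maintained by additions and subtractions.

root : ℕ → ℕ
root zero = 0
root (suc n) with suc (root n) * suc (root n) ≤? suc n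
... | yes _ = suc (root n)
... | no _  = root n

root²≤ : ∀ n → root n * root n ≤ n
root²≤ zero = z≤n
root²≤ (suc n) with suc (root n) * suc (root n) ≤? suc n
... | yes p = p
... | no _  = m≤n⇒m≤1+n (root²≤ n)

[1+root]²> : ∀ n → n < suc (root n) * suc (root n)
[1+root]²> zero = s≤s z≤n
[1+root]²> (suc n) with suc (root n) * suc (root n) ≤? suc n
... | yes _ = ≤-<-trans ([1+root]²> n) (*-mono-< (n<1+n (suc (root n))) (n<1+n (suc (root n))))
... | no ¬p = ≰⇒> ¬p

square-cancel-< : ∀ {m n} → m * m < n * n → m < n
square-cancel-< {m} {n} m²<n² = ≰⇒> λ n≤m → <⇒≱ m²<n² (*-mono-≤ n≤m n≤m)

n≤n*n : ∀ n → n ≤ n * n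
n≤n*n zero = z≤n
n≤n*n n@(suc _) = m≤m*n n n

square-suc : ∀ n → suc n * suc n ≡ suc (n * n + (n + n))
square-suc = solve-∀

-- Distances

least : ∀ {P : ℕ → Set} → Decidable P → ∀ {k} → P k → ∃[ m ] IsMinimum P m
least P? {zero} Pk = 0 , Pk , λ _ _ → z≤n
least {P} P? {suc k} Pk with P? 0
... | yes P0 = 0 , P0 , λ _ _ → z≤n
... | no ¬P0 with least (P? ∘ suc) {k} Pk
...   | m , Pm , min = suc m , Pm , λ where
          zero P0    → contradiction P0 ¬P0
          (suc j) Pj → s≤s (min j Pj)

_++ʷ_ : ∀ {G j k u v w} → Walk G j u v → Walk G k v w → Walk G (j + k) u w
[]      ++ʷ q = q
(e ∷ p) ++ʷ q = e ∷ (p ++ʷ q)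

adj-sym : ∀ G {u v} → Adj G u v → Adj G v u
adj-sym G {u} {v} = subst T (Graph.sym G u v)

reverseʷ : ∀ {G k u v} → Walk G k u v → Walk G k v u
reverseʷ [] = []
reverseʷ {G} {suc k} {u} {v} (e ∷ p) =
  subst (λ j → Walk G j v u) (+-comm k 1) (reverseʷ p ++ʷ (adj-sym G e ∷ []))

-- Decidability lets `least` extract a shortest walk from connectedness.
walk? : ∀ G k u v → Dec (Walk G k u v)
walk? G zero u v = map′ (λ { refl → [] }) (λ { [] → refl }) (u Fin.≟ v)
walk? G (suc k) u w =
  map′ (λ { (_ , e , p) → e ∷ p }) (λ { (e ∷ p) → _ , e , p })
       (any? λ v → T? (adj G u v) ×-dec walk? G k v w)

module Metric (G : Graph) (connected : Connected G) where

  distance : ∀ u v → ∃[ k ] Distance G u v k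
  distance u v = least (λ k → walk? G k u v) (proj₂ (connected u v))

  d : Vertex G → Vertex G → ℕ
  d u v = proj₁ (distance u v)

  geodesic : ∀ u v → Walk G (d u v) u v
  geodesic u v = proj₁ (proj₂ (distance u v))

  d≤ : ∀ {k u v} → Walk G k u v → d u v ≤ k
  d≤ {k} {u} {v} = proj₂ (proj₂ (distance u v)) k

  d-sym : ∀ u v → d u v ≡ d v u
  d-sym u v = ≤-antisym (d≤ (reverseʷ (geodesic v u))) (d≤ (reverseʷ (geodesic u v)))

  d-triangle : ∀ u v w → d u w ≤ d u v + d v w
  d-triangle u v w = d≤ (geodesic u v ++ʷ geodesic v w)

  -- A suffix of a shortest walk is again shortest, since a shortcut would shorten the whole walk.
  -- So the distance to `s` drops by exactly one with each edge and takes every value on the way.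
  levels : ∀ {k w s} → Walk G k w s → d w s ≡ k → ∀ {j} → j ≤ k → ∃[ v ] d v s ≡ j
  levels {w = w} [] dws≡0 z≤n = w , dws≡0
  levels {suc k} {w} {s} (_∷_ {v = v} e p) dws≡1+k {j} j≤1+k with m≤n⇒m<n∨m≡n j≤1+k
  ... | inj₂ refl = w , dws≡1+k
  ... | inj₁ j<1+k = levels p (≤-antisym (d≤ p) k≤dvs) (s≤s⁻¹ j<1+k)
    where
    k≤dvs : k ≤ d v s
    k≤dvs = s≤s⁻¹ (subst (_≤ suc (d v s)) dws≡1+k (d≤ (e ∷ geodesic v s)))

  level : ∀ w s {j} → j ≤ d w s → ∃[ v ] d v s ≡ j
  level w s = levels (geodesic w s) refl

  -- The levels up to `d w s` are disjoint and inhabited. The bound lets the order act as infinity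
  -- and makes n rounds of relaxation enough.
  d<order : ∀ w s → d w s < order G
  d<order w s = injective⇒≤ {f = f} f-injective
    where
    lv : (i : Fin (suc (d w s))) → ∃[ v ] d v s ≡ toℕ i
    lv i = level w s (s≤s⁻¹ (toℕ<n i))
    f : Fin (suc (d w s)) → Vertex G
    f i = proj₁ (lv i)
    f-injective : ∀ {i j} → f i ≡ f j → i ≡ j
    f-injective {i} {j} fi≡fj = toℕ-injective
      (trans (sym (proj₂ (lv i))) (trans (cong (λ v → d v s) fi≡fj) (proj₂ (lv j))))

  d-triangle-flip : ∀ u v w → d u w ≤ d v w + d u v
  d-triangle-flip u v w = ≤-trans (d-triangle u v w) (≤-reflexive (+-comm (d u v) (d v w)))

-- Burning

-- Rounds count from 1 and indices from 0, so the strict inequality says that `k` is at most the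
-- number of rounds left after the one of `a i`.
burned⇒walk : ∀ {G m} {a : Schedule G m} {r v} → Burned G a r v →
              ∃[ i ] ∃[ k ] Walk G k v (a i) × toℕ i + k < r
burned⇒walk (activate i) = i , 0 , [] , ≤-reflexive (cong suc (+-identityʳ (toℕ i)))
burned⇒walk {G} {r = suc r} (spread b e) with burned⇒walk b
... | i , k , p , i+k<r = i , suc k , adj-sym G e ∷ p ,
        s≤s (subst (_≤ r) (sym (+-suc (toℕ i) k)) i+k<r)
burned⇒walk (stay b) with burned⇒walk b
... | i , k , p , i+k<r = i , k , p , m<n⇒m<1+n i+k<r

spread-walk : ∀ {G m} {a : Schedule G m} {r k v w} →
              Burned G a r v → Walk G k v w → Burned G a (r + k) w
spread-walk {G} {a = a} {r} {v = v} b [] = subst (λ r → Burned G a r v) (sym (+-identityʳ r)) b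
spread-walk {G} {a = a} {r} {suc k} {w = w} b (e ∷ p) =
  subst (λ r → Burned G a r w) (sym (+-suc r k)) (spread-walk (spread b e) p)

stay-until : ∀ {G m} {a : Schedule G m} {r r′ v} → r ≤‴ r′ → Burned G a r v → Burned G a r′ v
stay-until ≤‴-refl b = b
stay-until (≤‴-step le) b = stay-until le (stay b)

walk⇒burned : ∀ {G m} {a : Schedule G m} {k v} i → Walk G k (a i) v →
              toℕ i + k < m → Burned G a m v
walk⇒burned i p i+k<m = stay-until (≤⇒≤‴ i+k<m) (spread-walk (activate i) p)

-- The intervals from ρ² to ρ² + 2ρ are disjoint, as the next square is ρ² + 2ρ + 1.
square-interval-unique : ∀ {ρ σ x y} → x ≤ ρ + ρ → y ≤ σ + σ → ρ * ρ + x ≡ σ * σ + y → ρ ≡ σ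
square-interval-unique {ρ} {σ} {x} {y} x≤ y≤ eq = ≤-antisym (half ρ σ y≤ eq) (half σ ρ x≤ (sym eq))
  where
  half : ∀ ρ σ {x y} → y ≤ σ + σ → ρ * ρ + x ≡ σ * σ + y → ρ ≤ σ
  half ρ σ {x} {y} y≤ eq = s≤s⁻¹ (square-cancel-< (begin-strict
    ρ * ρ              ≤⟨ m≤m+n (ρ * ρ) x ⟩
    ρ * ρ + x          ≡⟨ eq ⟩
    σ * σ + y          ≤⟨ +-monoʳ-≤ (σ * σ) y≤ ⟩
    σ * σ + (σ + σ)    <⟨ n<1+n _ ⟩
    suc (σ * σ + (σ + σ)) ≡⟨ square-suc σ ⟨
    suc σ * suc σ      ∎))
    where open ≤-Reasoning

module _ (G : Graph) (connected : Connected G) where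
  open Metric G connected

  -- The activator with remaining radius ρ burns vertices on at most 2ρ + 1
  -- of the distance levels 0, …, d u v; numbering these levels from ρ²
  -- injects all levels into the numbers below m².
  diameter<burning² : ∀ {m} (a : Schedule G m) → Burns G a → ∀ u v → d u v < m * m
  diameter<burning² {m} a burns u v = injective⇒≤ {f = λ j → fromℕ< (code<m² j)} λ {i} {j} eq →
    code-injective (fromℕ<-injective (code i) (code j) (code<m² i) (code<m² j) eq)
    where
    Level : Set
    Level = Fin (suc (d u v))

    point : ∀ (j : Level) → ∃[ w ] d w v ≡ toℕ j
    point j = level u v (s≤s⁻¹ (toℕ<n j))

    source : ∀ (j : Level) → ∃[ i ] ∃[ k ] Walk G k (proj₁ (point j)) (a i) × toℕ i + k < m
    source j = burned⇒walk (burns (proj₁ (point j)))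

    act : Level → Fin m
    act j = proj₁ (source j)

    ρ c code : Level → ℕ
    ρ j = m ∸ suc (toℕ (act j))
    c j = d (a (act j)) v
    code j = ρ j * ρ j + (toℕ j + ρ j ∸ c j)

    k≤ρ : ∀ j → d (proj₁ (point j)) (a (act j)) ≤ ρ j
    k≤ρ j with source j
    ... | i , k , p , i+k<m = ≤-trans (d≤ p)
      (subst (_≤ m ∸ suc (toℕ i)) (m+n∸m≡n (suc (toℕ i)) k) (∸-monoˡ-≤ (suc (toℕ i)) i+k<m))

    c≤ : ∀ j → c j ≤ toℕ j + ρ j
    c≤ j = begin
      c j ≤⟨ d-triangle-flip (a (act j)) (proj₁ (point j)) v ⟩
      d (proj₁ (point j)) v + d (a (act j)) (proj₁ (point j))
        ≡⟨ cong₂ _+_ (proj₂ (point j)) (d-sym (a (act j)) (proj₁ (point j))) ⟩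
      toℕ j + d (proj₁ (point j)) (a (act j)) ≤⟨ +-monoʳ-≤ (toℕ j) (k≤ρ j) ⟩
      toℕ j + ρ j ∎
      where open ≤-Reasoning

    j≤ : ∀ j → toℕ j ≤ c j + ρ j
    j≤ j = begin
      toℕ j ≡⟨ proj₂ (point j) ⟨
      d (proj₁ (point j)) v ≤⟨ d-triangle-flip (proj₁ (point j)) (a (act j)) v ⟩
      c j + d (proj₁ (point j)) (a (act j)) ≤⟨ +-monoʳ-≤ (c j) (k≤ρ j) ⟩
      c j + ρ j ∎
      where open ≤-Reasoning

    offset≤ : ∀ j → toℕ j + ρ j ∸ c j ≤ ρ j + ρ j
    offset≤ j = m≤n+o⇒m∸n≤o _ (c j)
      (subst (toℕ j + ρ j ≤_) (+-assoc (c j) (ρ j) (ρ j)) (+-monoˡ-≤ (ρ j) (j≤ j)))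

    code<m² : ∀ j → code j < m * m
    code<m² j = begin-strict
      code j ≤⟨ +-monoʳ-≤ (ρ j * ρ j) (offset≤ j) ⟩
      ρ j * ρ j + (ρ j + ρ j) <⟨ n<1+n _ ⟩
      suc (ρ j * ρ j + (ρ j + ρ j)) ≡⟨ square-suc (ρ j) ⟨
      suc (ρ j) * suc (ρ j) ≤⟨ *-mono-≤ ρ<m ρ<m ⟩
      m * m ∎
      where
      open ≤-Reasoning
      ρ<m : ρ j < m
      ρ<m = ∸-monoʳ-< {m} {suc (toℕ (act j))} {0} (s≤s z≤n) (toℕ<n (act j))

    code-injective : ∀ {i j} → code i ≡ code j → i ≡ j
    code-injective {i} {j} eq = toℕ-injective (+-cancelʳ-≡ (ρ i) (toℕ i) (toℕ j)
      (∸-cancelʳ-≡ (c≤ i) (subst₂ _≤_ (sym cc) (cong (toℕ j +_) (sym ρρ)) (c≤ j)) offsets))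
      where
      ρρ : ρ i ≡ ρ j
      ρρ = square-interval-unique (offset≤ i) (offset≤ j) eq
      -- Different rounds leave different radii, so `ρ` identifies the activator and with it `c`.
      -- The truncated subtractions can be cancelled thanks to `c≤`.
      aa : act i ≡ act j
      aa = toℕ-injective (suc-injective (∸-cancelˡ-≡ (toℕ<n (act i)) (toℕ<n (act j)) ρρ))
      cc : c i ≡ c j
      cc = cong (λ x → d (a x) v) aa
      offsets : toℕ i + ρ i ∸ c i ≡ toℕ j + ρ i ∸ c i
      offsets = +-cancelˡ-≡ (ρ i * ρ i) _ _ (begin
        code i ≡⟨ eq ⟩
        code j ≡⟨ cong₂ (λ r x → r * r + (toℕ j + r ∸ x)) ρρ cc ⟨
        ρ i * ρ i + (toℕ j + ρ i ∸ c i) ∎)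
        where open ≡-Reasoning

-- Path decompositions

module Separators (G : Graph) (connected : Connected G) (D : PathDecomposition G)
                  (L : ℕ)
                  (bounded : ∀ {i x y} → x ∈ PathDecomposition.bag D i →
                             y ∈ PathDecomposition.bag D i →
                             Metric.d G connected x y ≤ L) where
  open Metric G connected
  open PathDecomposition D

  -- The order ⊑ is either ≤ or ≥, according to the end of the decomposition that
  -- the farthest vertex u is near to.
  module Ordered
    (_⊑_ : Fin size → Fin size → Set) (⊑-total : Total _⊑_)
    (convex : ∀ {v i j k} → i ⊑ j → j ⊑ k → v ∈ bag i → v ∈ bag k → v ∈ bag j)
    where

    -- The two ends of an edge share a bag `l`. If `l` is at or beyond `j`, convexity puts the
    -- current vertex into bag `j`; otherwise the next vertex is still on the near side, and the
    -- argument continues from `l`.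
    separate : ∀ {i j k n x y} → i ⊑ j → j ⊑ k → x ∈ bag i → y ∈ bag k → Walk G n x y →
               ∃[ z ] ∃[ a ] ∃[ b ] z ∈ bag j × Walk G a x z × Walk G b z y × a + b ≡ n
    separate {x = x} i⊑j j⊑k x∈i x∈k [] = x , 0 , 0 , convex i⊑j j⊑k x∈i x∈k , [] , [] , refl
    separate {j = j} {x = x} i⊑j j⊑k x∈i y∈k (_∷_ {v = v} e p) with edges x v e
    ... | l , x∈l , v∈l with ⊑-total j l
    ...   | inj₁ j⊑l = x , 0 , _ , convex i⊑j j⊑l x∈i x∈l , [] , e ∷ p , refl
    ...   | inj₂ l⊑j with separate l⊑j j⊑k v∈l y∈k p
    ...     | z , a , b , z∈j , q , r , a+b≡n = z , suc a , b , z∈j , e ∷ q , r , cong suc a+b≡n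

    -- A shortest walk from `x` to `z` meets the bag of `y` in some `s` within `L` of `y`; going
    -- through `y` costs this detour there and back.
    via-middle : ∀ {i j k x y z} → i ⊑ j → j ⊑ k → x ∈ bag i → y ∈ bag j → z ∈ bag k →
                 d x y + d y z ≤ d x z + (L + L)
    via-middle {x = x} {y} {z} i⊑j j⊑k x∈i y∈j z∈k
      with separate i⊑j j⊑k x∈i z∈k (geodesic x z)
    ... | s , a , b , s∈j , p , q , a+b≡ = begin
      d x y + d y z                         ≤⟨ +-mono-≤ (d-triangle x s y) (d-triangle y s z) ⟩
      (d x s + d s y) + (d y s + d s z)     ≤⟨ +-mono-≤ (+-mono-≤ (d≤ p) (bounded s∈j y∈j))
                                                        (+-mono-≤ (bounded y∈j s∈j) (d≤ q)) ⟩
      (a + L) + (L + b)                     ≡⟨ regroup a b L ⟩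
      (a + b) + (L + L)                     ≡⟨ cong (_+ (L + L)) a+b≡ ⟩
      d x z + (L + L)                       ∎
      where
      open ≤-Reasoning
      regroup : ∀ a b L → (a + L) + (L + b) ≡ (a + b) + (L + L)
      regroup = solve-∀

    module _ {o u : Vertex G} (farthest : ∀ w → d w o ≤ d u o)
             {iₒ iᵤ : Fin size} (o∈ : o ∈ bag iₒ) (u∈ : u ∈ bag iᵤ) (iᵤ⊑iₒ : iᵤ ⊑ iₒ)
             where

      -- Here the choice of `u` enters: a vertex beyond `u`, as seen from `o`, and more than 2L away
      -- from `u` would be farther from `o` than `u` is.
      near-end : ∀ {w i} → w ∈ bag i → i ⊑ iᵤ → d w u ≤ L + L
      near-end {w} w∈ i⊑iᵤ = +-cancelʳ-≤ (d u o) (d w u) (L + L) (begin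
        d w u + d u o    ≤⟨ via-middle i⊑iᵤ iᵤ⊑iₒ w∈ u∈ o∈ ⟩
        d w o + (L + L)  ≤⟨ +-monoˡ-≤ (L + L) (farthest w) ⟩
        d u o + (L + L)  ≡⟨ +-comm (d u o) (L + L) ⟩
        (L + L) + d u o  ∎)
        where open ≤-Reasoning

      -- The constant is dictated by `close-near-end`, which pays 2L twice; in `close-ordered`, 2L
      -- would do.
      Close : Vertex G → Vertex G → Set
      Close w z = d w z ≤ ∣ d w u - d z u ∣ + 4 * L

      close-sym : ∀ {w z} → Close w z → Close z w
      close-sym {w} {z} = subst₂ (λ x y → x ≤ y + 4 * L) (d-sym w z) (∣-∣-comm (d w u) (d z u))

      close-near-end : ∀ {w z i} → w ∈ bag i → i ⊑ iᵤ → Close w z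
      close-near-end {w} {z} w∈ i⊑iᵤ = begin
        d w z                                  ≤⟨ d-triangle w u z ⟩
        d w u + d u z                          ≡⟨ cong (d w u +_) (d-sym u z) ⟩
        d w u + d z u                          ≤⟨ +-monoʳ-≤ (d w u) (m≤n+∣n-m∣ (d z u) (d w u)) ⟩
        d w u + (d w u + ∣ d w u - d z u ∣)    ≤⟨ +-mono-≤ dwu≤ (+-monoˡ-≤ _ dwu≤) ⟩
        (L + L) + ((L + L) + ∣ d w u - d z u ∣) ≡⟨ regroup L ∣ d w u - d z u ∣ ⟩
        ∣ d w u - d z u ∣ + 4 * L              ∎
        where
        open ≤-Reasoning
        dwu≤ = near-end w∈ i⊑iᵤ
        regroup : ∀ L x → (L + L) + ((L + L) + x) ≡ x + 4 * L
        regroup = solve-∀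

      close-ordered : ∀ {w z i j} → w ∈ bag i → z ∈ bag j → iᵤ ⊑ i → i ⊑ j → Close w z
      close-ordered {w} {z} w∈ z∈ iᵤ⊑i i⊑j = +-cancelˡ-≤ (d u w) _ _ (begin
        d u w + d w z                            ≤⟨ via-middle iᵤ⊑i i⊑j u∈ w∈ z∈ ⟩
        d u z + (L + L)                          ≡⟨ cong (_+ (L + L)) (d-sym u z) ⟩
        d z u + (L + L)                          ≤⟨ +-monoˡ-≤ (L + L) (m≤n+∣n-m∣ (d z u) (d w u)) ⟩
        d w u + ∣ d w u - d z u ∣ + (L + L)      ≤⟨ m≤m+n _ (L + L) ⟩
        d w u + ∣ d w u - d z u ∣ + (L + L) + (L + L)
                                                 ≡⟨ regroup (d w u) ∣ d w u - d z u ∣ L ⟩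
        d w u + (∣ d w u - d z u ∣ + 4 * L)      ≡⟨ cong (_+ (∣ d w u - d z u ∣ + 4 * L)) (d-sym w u) ⟩
        d u w + (∣ d w u - d z u ∣ + 4 * L)      ∎)
        where
        open ≤-Reasoning
        regroup : ∀ a x L → a + x + (L + L) + (L + L) ≡ a + (x + 4 * L)
        regroup = solve-∀

      close : ∀ w z → Close w z
      close w z with nonempty w | nonempty z
      ... | i , w∈ | j , z∈ with ⊑-total i iᵤ | ⊑-total j iᵤ | ⊑-total i j
      ... | inj₁ i⊑iᵤ | _ | _ = close-near-end w∈ i⊑iᵤ
      ... | inj₂ _ | inj₁ j⊑iᵤ | _ = close-sym (close-near-end z∈ j⊑iᵤ)
      ... | inj₂ iᵤ⊑i | inj₂ _ | inj₁ i⊑j = close-ordered w∈ z∈ iᵤ⊑i i⊑j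
      ... | inj₂ _ | inj₂ iᵤ⊑j | inj₂ j⊑i = close-sym (close-ordered z∈ w∈ iᵤ⊑j j⊑i)

  d≤difference : ∀ {o u} → (∀ w → d w o ≤ d u o) →
                 ∀ w z → d w z ≤ ∣ d w u - d z u ∣ + 4 * L
  d≤difference {o} {u} farthest with nonempty o | nonempty u
  ... | iₒ , o∈ | iᵤ , u∈ with Fin.≤-total iᵤ iₒ
  ...   | inj₁ iᵤ≤iₒ = Ordered.close Fin._≤_ Fin.≤-total
                         (λ {v} {i} {j} {k} → contiguous v i j k) farthest o∈ u∈ iᵤ≤iₒ
  ...   | inj₂ iₒ≤iᵤ = Ordered.close (flip Fin._≤_) (flip Fin.≤-total)
                         (λ {v} {i} {j} {k} i≥j j≥k v∈i v∈k → contiguous v k j i j≥k i≥j v∈k v∈i)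
                         farthest o∈ u∈ iₒ≤iᵤ

-- Counted loops

-- The base `suc n` is positive, so powers are monotone in the exponent, and `poly-+` may add
-- exponents instead of taking their maximum.
PolynomiallyBounded : (ℕ → ℕ) → Set
PolynomiallyBounded f = ∃[ c ] ∃[ k ] (∀ n → f n ≤ c * suc n ^ k)

poly-const : ∀ c → PolynomiallyBounded (λ _ → c)
poly-const c = c , 0 , λ n → ≤-reflexive (sym (*-identityʳ c))

poly-id : PolynomiallyBounded (λ n → n)
poly-id = 1 , 1 , λ n → subst (n ≤_) (sym (trans (*-identityˡ _) (*-identityʳ _))) (n≤1+n n)

poly-+ : ∀ {f g} → PolynomiallyBounded f → PolynomiallyBounded g →
         PolynomiallyBounded (λ n → f n + g n)
poly-+ {f} {g} (c , k , f≤) (e , l , g≤) = c + e , k + l , λ n → begin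
  f n + g n                                  ≤⟨ +-mono-≤ (f≤ n) (g≤ n) ⟩
  c * suc n ^ k + e * suc n ^ l              ≤⟨ +-mono-≤ (*-monoʳ-≤ c (^-monoʳ-≤ (suc n) (m≤m+n k l)))
                                                         (*-monoʳ-≤ e (^-monoʳ-≤ (suc n) (m≤n+m l k))) ⟩
  c * suc n ^ (k + l) + e * suc n ^ (k + l)  ≡⟨ *-distribʳ-+ (suc n ^ (k + l)) c e ⟨
  (c + e) * suc n ^ (k + l)                  ∎
  where open ≤-Reasoning

poly-* : ∀ {f g} → PolynomiallyBounded f → PolynomiallyBounded g →
         PolynomiallyBounded (λ n → f n * g n)
poly-* {f} {g} (c , k , f≤) (e , l , g≤) = c * e , k + l , λ n → begin
  f n * g n                              ≤⟨ *-mono-≤ (f≤ n) (g≤ n) ⟩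
  (c * suc n ^ k) * (e * suc n ^ l)      ≡⟨ [m*n]*[o*p]≡[m*o]*[n*p] c (suc n ^ k) e (suc n ^ l) ⟩
  (c * e) * (suc n ^ k * suc n ^ l)      ≡⟨ cong (c * e *_) (^-distribˡ-+-* (suc n) k l) ⟨
  (c * e) * suc n ^ (k + l)              ∎
  where open ≤-Reasoning

infixr 4 _⨟_

-- The body of for x c b runs once for each value of x below c + n, where n is
-- the content of variable 0.
data Command : Set where
  set  : ℕ → Expr → Command
  put  : ℕ → Expr → Expr → Command
  _⨟_  : Command → Command → Command
  when : Expr → Command → Command
  for  : ℕ → ℕ → Command → Command

compile : Command → Program
compile (set x e)   = assign x e
compile (put x e f) = write x e f
compile (b ⨟ c)     = compile b ⨾ compile c
compile (when e b)  = cond e (compile b) skip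
compile (for x c b) =
  assign x (lit 0) ⨾ while (lit c ⊕ var 0 ⊖ var x) (compile b ⨾ assign x (var x ⊕ lit 1))

assignScalar : ℕ → ℕ → State → State
assignScalar x a s = ⟨ scalar s [ x ↦ a ] , array s ⟩

iterate : ℕ → (State → State) → State → State
iterate zero    f s = s
iterate (suc k) f s = iterate k f (f s)

-- The number of iterations is fixed on entering a loop, which makes this definition structurally
-- recursive.
run : Command → State → State
step : ℕ → Command → State → State

run (set x e) s   = assignScalar x (⟦ e ⟧ s) s
run (put x e f) s = ⟨ scalar s , array s [ x ↦ array s x [ ⟦ e ⟧ s ↦ ⟦ f ⟧ s ] ] ⟩
run (b ⨟ c) s     = run c (run b s)
run (when e b) s with ⟦ e ⟧ s
... | zero  = s
... | suc _ = run b s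
run (for x c b) s = iterate (c + scalar s 0) (step x b) (assignScalar x 0 s)

step x b s = assignScalar x (scalar (run b s) x + 1) (run b s)

-- For concrete numerals this computes to the unit type, so that for a concrete command the
-- conditions `Keeps`, `KeepsArray` and `WellFormed` are filled in by `_`.
_≠ᵇ_ : ℕ → ℕ → Set
x ≠ᵇ y = T (not (x ≡ᵇ y))

Keeps : ℕ → Command → Set
Keeps y (set x e)   = x ≠ᵇ y
Keeps y (put x e f) = T true
Keeps y (b ⨟ c)     = Keeps y b × Keeps y c
Keeps y (when e b)  = Keeps y b
Keeps y (for x c b) = x ≠ᵇ y × Keeps y b

KeepsArray : ℕ → Command → Set
KeepsArray y (set x e)   = T true
KeepsArray y (put x e f) = x ≠ᵇ y
KeepsArray y (b ⨟ c)     = KeepsArray y b × KeepsArray y c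
KeepsArray y (when e b)  = KeepsArray y b
KeepsArray y (for x c b) = KeepsArray y b

-- Loop limits and time bounds refer to the initial content of variable 0, which must therefore
-- survive, and a loop counter may change only by the increment that `compile` appends.
WellFormed : Command → Set
WellFormed (set x e)   = T true
WellFormed (put x e f) = T true
WellFormed (b ⨟ c)     = Keeps 0 b × WellFormed b × WellFormed c
WellFormed (when e b)  = WellFormed b
WellFormed (for x c b) = x ≠ᵇ 0 × Keeps 0 b × Keeps x b × WellFormed b

update-same : ∀ {A : Set} (f : ℕ → A) x {a} → (f [ x ↦ a ]) x ≡ a
update-same f x with x ≡ᵇ x | ≡⇒≡ᵇ x x refl
... | true | _ = refl

update-other : ∀ {A : Set} (f : ℕ → A) {x y a} → x ≢ y → (f [ x ↦ a ]) y ≡ f y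
update-other f {x} {y} x≢y with x ≡ᵇ y | ≡ᵇ⇒≡ x y
... | true  | x≡y = contradiction (x≡y _) x≢y
... | false | _   = refl

update-≠ᵇ : ∀ {A : Set} (f : ℕ → A) x y {a} → x ≠ᵇ y → (f [ x ↦ a ]) y ≡ f y
update-≠ᵇ f x y x≠y with x ≡ᵇ y
... | false = refl

iterate-preserves : ∀ {A : Set} (g : State → A) {f} → (∀ s → g (f s) ≡ g s) →
                    ∀ k s → g (iterate k f s) ≡ g s
iterate-preserves g pres zero    s = refl
iterate-preserves g {f} pres (suc k) s = trans (iterate-preserves g pres k (f s)) (pres s)

keeps : ∀ b {y} → Keeps y b → ∀ s → scalar (run b s) y ≡ scalar s y
keeps (set x e) {y} x≠y s = update-≠ᵇ (scalar s) x y x≠y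
keeps (put x e f) _ s = refl
keeps (b ⨟ c) (kb , kc) s = trans (keeps c kc (run b s)) (keeps b kb s)
keeps (when e b) kb s with ⟦ e ⟧ s
... | zero  = refl
... | suc _ = keeps b kb s
keeps (for x c b) {y} (x≠y , kb) s = trans
  (iterate-preserves (λ s → scalar s y)
    (λ s → trans (update-≠ᵇ (scalar (run b s)) x y x≠y) (keeps b kb s)) (c + scalar s 0) _)
  (update-≠ᵇ (scalar s) x y x≠y)

keepsArray : ∀ b {y} → KeepsArray y b → ∀ s → array (run b s) y ≡ array s y
keepsArray (set x e) _ s = refl
keepsArray (put x e f) {y} x≠y s = update-≠ᵇ (array s) x y x≠y
keepsArray (b ⨟ c) (kb , kc) s = trans (keepsArray c kc (run b s)) (keepsArray b kb s)
keepsArray (when e b) kb s with ⟦ e ⟧ s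
... | zero  = refl
... | suc _ = keepsArray b kb s
keepsArray (for x c b) {y} kb s =
  iterate-preserves (λ s → array s y) (keepsArray b kb) (c + scalar s 0) _

-- The 8 steps are the initialisation (2) and the last test (6), the 10 steps of
-- an iteration are the test (6) and the increment (4).
timeBound : Command → ℕ → ℕ
timeBound (set x e) n   = suc (cost e)
timeBound (put x e f) n = suc (cost e + cost f)
timeBound (b ⨟ c) n     = timeBound b n + timeBound c n
timeBound (when e b) n  = suc (cost e) + (timeBound b n + 1)
timeBound (for x c b) n = 8 + (c + n) * (10 + timeBound b n)

timeBound-polynomial : ∀ b → PolynomiallyBounded (timeBound b)
timeBound-polynomial (set x e) = poly-const _
timeBound-polynomial (put x e f) = poly-const _
timeBound-polynomial (b ⨟ c) = poly-+ (timeBound-polynomial b) (timeBound-polynomial c)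
timeBound-polynomial (when e b) =
  poly-+ (poly-const (suc (cost e))) (poly-+ (timeBound-polynomial b) (poly-const 1))
timeBound-polynomial (for x c b) = poly-+ (poly-const 8)
  (poly-* (poly-+ (poly-const c) poly-id) (poly-+ (poly-const 10) (timeBound-polynomial b)))

module Loop {x : ℕ} {b : Command} (x≠0 : x ≠ᵇ 0) (k0 : Keeps 0 b) (kx : Keeps x b) where

  step-counter : ∀ s → scalar (step x b s) x ≡ suc (scalar s x)
  step-counter s = trans (update-same (scalar (run b s)) x)
                         (trans (+-comm _ 1) (cong suc (keeps b kx s)))

  step-bound : ∀ s → scalar (step x b s) 0 ≡ scalar s 0
  step-bound s = trans (update-≠ᵇ (scalar (run b s)) x 0 x≠0) (keeps b k0 s)

halts : ∀ b → WellFormed b → ∀ s →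
        ∃[ t ] (s ⊢ compile b ⇓[ t ] run b s) × t ≤ timeBound b (scalar s 0)
halts (set x e) _ s = _ , ⇓assign , ≤-refl
halts (put x e f) _ s = _ , ⇓write , ≤-refl
halts (b ⨟ c) (kb , wb , wc) s with halts b wb s | halts c wc (run b s)
... | t , h , t≤ | t′ , h′ , t′≤ = t + t′ , ⇓seq h h′ ,
  +-mono-≤ t≤ (subst (λ n → t′ ≤ timeBound c n) (keeps b kb s) t′≤)
halts (when e b) wb s with ⟦ e ⟧ s in eq
... | zero = _ , ⇓false eq ⇓skip , +-monoʳ-≤ (suc (cost e)) (m≤n+m 1 _)
... | suc _ with halts b wb s
...   | t , h , t≤ = _ , ⇓true (λ z → contradiction (trans (sym eq) z) λ ()) h ,
          +-monoʳ-≤ (suc (cost e)) (≤-trans t≤ (m≤m+n _ 1))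
halts (for x c b) (x≠0 , k0 , kx , wb) s with loop (c + n) (assignScalar x 0 s) start refl′
  where
  n = scalar s 0
  refl′ : scalar (assignScalar x 0 s) 0 ≡ n
  refl′ = update-≠ᵇ (scalar s) x 0 x≠0
  start : scalar (assignScalar x 0 s) x + (c + n) ≡ c + n
  start = cong (_+ (c + n)) (update-same (scalar s) x)
  guard = lit c ⊕ var 0 ⊖ var x
  open Loop {x} {b} x≠0 k0 kx
  -- `k` is the number of iterations left; the equations make it the value of `guard`.
  loop : ∀ k r → scalar r x + k ≡ c + n → scalar r 0 ≡ n →
         ∃[ t ] (r ⊢ while guard (compile b ⨾ assign x (var x ⊕ lit 1)) ⇓[ t ] iterate k (step x b) r)
              × t ≤ 6 + k * (10 + timeBound b n)
  loop zero r rx r0 = 6 , ⇓exit (m≤n⇒m∸n≡0 (≤-reflexive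
    (trans (cong (c +_) r0) (trans (sym rx) (+-identityʳ _))))) , ≤-refl
  loop (suc k) r rx r0
    with halts b wb r
       | loop k (step x b r)
              (trans (cong (_+ k) (step-counter r)) (trans (sym (+-suc _ k)) rx))
              (trans (step-bound r) r0)
  ... | t , h , t≤ | t′ , h′ , t′≤ = _ , ⇓loop running (⇓seq h ⇓assign) h′ , (begin
    6 + (t + 4 + t′)                       ≤⟨ +-monoʳ-≤ 6 (+-mono-≤ (+-monoˡ-≤ 4 t≤n) t′≤) ⟩
    6 + (timeBound b n + 4 + (6 + k * (10 + timeBound b n)))
      ≡⟨ regroup (timeBound b n) (k * (10 + timeBound b n)) ⟩
    6 + (10 + timeBound b n + k * (10 + timeBound b n))  ∎)
    where
    open ≤-Reasoning
    t≤n : t ≤ timeBound b n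
    t≤n = subst (λ n → t ≤ timeBound b n) r0 t≤
    running : ⟦ guard ⟧ r ≢ 0
    running eq = <⇒≱ (m<m+n (scalar r x) (s≤s z≤n))
      (subst (_≤ scalar r x) (trans (cong (c +_) r0) (sym rx)) (m∸n≡0⇒m≤n eq))
    regroup : ∀ a y → 6 + (a + 4 + (6 + y)) ≡ 6 + (10 + a + y)
    regroup = solve-∀
... | t , h , t≤ = _ , ⇓seq ⇓assign h , +-monoʳ-≤ 2 t≤

-- The invariant rule: `P i` describes the state in which the counter has just become `i`. The
-- values of variable 0 and of the counter are supplied at each iteration, so invariants need not
-- carry them.
for-rule : ∀ (P : ℕ → State → Set) {x c b n} → x ≠ᵇ 0 → Keeps 0 b → Keeps x b →
           ∀ s → scalar s 0 ≡ n → P 0 (assignScalar x 0 s) →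
           (∀ i s → i < c + n → scalar s 0 ≡ n → scalar s x ≡ i → P i s → P (suc i) (step x b s)) →
           P (c + n) (run (for x c b) s)
for-rule P {x} {c} {b} {n} x≠0 k0 kx s refl P0 next =
  subst (λ k → P k (run (for x c b) s)) (+-identityʳ (c + n))
    (loop (c + n) _ (+-identityʳ (c + n))
          (update-≠ᵇ (scalar s) x 0 x≠0) (update-same (scalar s) x) P0)
  where
  open Loop {x} {b} x≠0 k0 kx
  loop : ∀ k {i} r → k + i ≡ c + n → scalar r 0 ≡ n → scalar r x ≡ i → P i r →
         P (k + i) (iterate k (step x b) r)
  loop zero    r _ _ _ p = p
  loop (suc k) {i} r k+i≡ r0 rx p =
    subst (λ j → P j (iterate k (step x b) (step x b r))) (+-suc k i)
      (loop k (step x b r) (trans (+-suc k i) k+i≡) (trans (step-bound r) r0)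
            (trans (step-counter r) (cong suc rx))
            (next i r (m+n≤o⇒n≤o k (≤-reflexive (trans (+-suc k i) k+i≡))) r0 rx p))

when-rule : ∀ (P : State → Set) e b s →
            (⟦ e ⟧ s ≢ 0 → P (run b s)) → (⟦ e ⟧ s ≡ 0 → P s) → P (run (when e b) s)
when-rule P e b s yes-case no-case with ⟦ e ⟧ s
... | zero  = no-case refl
... | suc _ = yes-case λ ()

-- The graph of run, so that the intermediate states of a sequence of commands can
-- be variables.
data Ran (b : Command) (s : State) : State → Set where
  ran : Ran b s (run b s)

ran-rule : ∀ {b s s′} → Ran b s s′ → (P : State → Set) → P (run b s) → P s′
ran-rule ran P p = p

ran-keeps : ∀ {b s s′} → Ran b s s′ → ∀ {y} → Keeps y b → scalar s′ y ≡ scalar s y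
ran-keeps {b} {s} ran k = keeps b k s

ran-keepsArray : ∀ {b s s′} → Ran b s s′ → ∀ {y} → KeepsArray y b → array s′ y ≡ array s y
ran-keepsArray {b} {s} ran k = keepsArray b k s

-- The algorithm

-- Variable 1 holds the source of the search, and then a vertex farthest from
-- it; variable 5 is the matrix index of the pair in variables 3 and 4; variable 7
-- is the square of variable 6. Array 1 holds the distances, and array 2 a vertex
-- for each distance. The order of the graph serves as infinity.
relax round distances farthest sweep layers squares : Command
relax =
  when (read 0 (var 5))
    (when (read 1 (var 4) ⊖ (read 1 (var 3) ⊕ lit 1))
      (put 1 (var 4) (read 1 (var 3) ⊕ lit 1)))
  ⨟ set 5 (var 5 ⊕ lit 1)
round = set 5 (lit 0) ⨟ for 3 0 (for 4 0 relax)
distances = for 4 0 (put 1 (var 4) (var 0)) ⨟ put 1 (var 1) (lit 0) ⨟ for 2 0 round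
farthest = for 4 0 (when (read 1 (var 4) ⊖ read 1 (var 1)) (set 1 (var 4)))
sweep = distances ⨟ farthest
layers = for 4 0 (put 2 (read 1 (var 4)) (var 4))
squares = for 4 0 (when (read 1 (var 1) ⊕ lit 1 ⊖ var 7)
  (set 7 (var 7 ⊕ (var 6 ⊕ var 6 ⊕ lit 1)) ⨟ set 6 (var 6 ⊕ lit 1)))

-- The address is the minimum of the eccentricity and ρ² + ρ, where ρ and ρ² are
-- in variables 6 and 7. The last C activators all have ρ = 0.
emitNext : Command
emitNext =
  set 6 (var 6 ⊖ lit 1)
  ⨟ set 7 (var 7 ⊖ (var 6 ⊕ var 6 ⊕ lit 1))
  ⨟ put 0 (var 4) (read 2 (read 1 (var 1) ⊖ (read 1 (var 1) ⊖ (var 7 ⊕ var 6))))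

-- `C` is the number of extra rounds. The loop writes C + n entries, enough for the M + C activators
-- because M ≤ n; what lies beyond them is harmless.
emit main : ℕ → Command
emit C = set 8 (var 6 ⊕ lit C) ⨟ for 4 C emitNext
main C = sweep ⨟ sweep ⨟ layers ⨟ squares ⨟ emit C

-- Variable 0 limits all loops, so the number of rounds waits in variable 8 until they are over.
algorithm : ℕ → Program
algorithm C = compile (main C) ⨾ assign 0 (var 8)

cong-app₂ : ∀ {f g : ℕ → ℕ} {x y} → f ≡ g → x ≡ y → f x ≡ g y
cong-app₂ = cong₂ (λ f x → f x)

index< : ∀ {n} (i j : Fin n) → n * toℕ i + toℕ j < n * n
index< {n} i j = subst (_< n * n) (toℕ-combine i j) (toℕ<n (combine i j))

matrix-entry : ∀ G u v →
               matrix G (order G * toℕ u + toℕ v) ≡ (if adj G u v then 1 else 0)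
matrix-entry G u v with order G * toℕ u + toℕ v <? order G * order G
... | yes p = cong (λ uv → if uncurry (adj G) uv then 1 else 0)
  (trans (cong (remQuot (order G)) index≡) (remQuot-combine u v))
  where
  index≡ : fromℕ< p ≡ combine u v
  index≡ = toℕ-injective (trans (toℕ-fromℕ< p) (sym (toℕ-combine u v)))
... | no ¬p = contradiction (index< u v) ¬p

-- Correctness of the distance sweeps

module SweepCorrect (G : Graph) (connected : Connected G) where
  open Metric G connected

  n : ℕ
  n = order G

  module _ (src : Vertex G) where

    -- Entries from n on stand for infinity; a smaller one must be the length of an actual walk. As
    -- distances are below n, either case makes the entry an upper bound of the distance.
    Sound : (ℕ → ℕ) → Set
    Sound D = ∀ w → n ≤ D (toℕ w) ⊎ Walk G (D (toℕ w)) w src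

    -- D₀ is the array at the start of a round, and D the array after the
    -- edges with matrix index below p have been relaxed.
    record Relaxed (D₀ : ℕ → ℕ) (p : ℕ) (D : ℕ → ℕ) : Set where
      field
        sound      : Sound D
        decreasing : ∀ w → D w ≤ D₀ w
        relaxed    : ∀ u v → Adj G u v → n * toℕ u + toℕ v < p → D (toℕ v) ≤ suc (D₀ (toℕ u))
    open Relaxed

    relaxed-skip : ∀ {D₀ D} {u v : Vertex G} → Relaxed D₀ (n * toℕ u + toℕ v) D →
                   (Adj G u v → D (toℕ v) ≤ suc (D₀ (toℕ u))) →
                   Relaxed D₀ (suc (n * toℕ u + toℕ v)) D
    relaxed-skip R _ .sound = R .sound
    relaxed-skip R _ .decreasing = R .decreasing
    relaxed-skip {u = u} {v} R new .relaxed u′ v′ e i<1+p with m<1+n⇒m<n∨m≡n i<1+p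
    ... | inj₁ i<p = R .relaxed u′ v′ e i<p
    ... | inj₂ i≡p with combine-injective u′ v′ u v (toℕ-injective
                          (trans (toℕ-combine u′ v′) (trans i≡p (sym (toℕ-combine u v)))))
    ...   | refl , refl = new e

    relaxed-update : ∀ {D₀ D p u v} → Relaxed D₀ p D → Adj G u v →
                     D (toℕ u) + 1 < D (toℕ v) →
                     Relaxed D₀ p (D [ toℕ v ↦ D (toℕ u) + 1 ])
    relaxed-update {D = D} {u = u} {v} R e shorter .sound w with toℕ v ≟ toℕ w
    ... | no v≢w = subst (λ k → n ≤ k ⊎ Walk G k w src) (sym (update-other D v≢w)) (R .sound w)
    ... | yes v≡w with toℕ-injective v≡w
    ...   | refl rewrite update-same D (toℕ v) {D (toℕ u) + 1} | +-comm (D (toℕ u)) 1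
            with R .sound u
    ...     | inj₁ n≤ = inj₁ (m≤n⇒m≤1+n n≤)
    ...     | inj₂ p  = inj₂ (adj-sym G e ∷ p)
    relaxed-update {D₀} {D} {u = u} {v} R e shorter .decreasing w with toℕ v ≟ w
    ... | no v≢w = subst (_≤ D₀ w) (sym (update-other D v≢w)) (R .decreasing w)
    ... | yes refl = subst (_≤ D₀ w) (sym (update-same D (toℕ v)))
                       (≤-trans (<⇒≤ shorter) (R .decreasing w))
    relaxed-update {D₀} {D} {u = u} {v} R e shorter .relaxed u′ v′ e′ i<p with toℕ v ≟ toℕ v′
    ... | no v≢v′ = subst (_≤ suc (D₀ (toℕ u′))) (sym (update-other D v≢v′))
                      (R .relaxed u′ v′ e′ i<p)
    ... | yes v≡v′ with toℕ-injective v≡v′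
    ...   | refl = subst (_≤ suc (D₀ (toℕ u′))) (sym (update-same D (toℕ v)))
                     (≤-trans (<⇒≤ shorter) (R .relaxed u′ v′ e′ i<p))

    -- The array is updated in place, so the entry that is read may already have been lowered in
    -- this round. That can only help.
    relaxed-new : ∀ {D₀ D p} → Relaxed D₀ p D → ∀ x → D x + 1 ≤ suc (D₀ x)
    relaxed-new {D₀} {D} R x = subst (_≤ suc (D₀ x)) (+-comm 1 (D x)) (s≤s (R .decreasing x))

    RelaxState : (ℕ → ℕ) → ℕ → ℕ → State → Set
    RelaxState D₀ i p s = scalar s 3 ≡ i × scalar s 5 ≡ p × array s 0 ≡ matrix G
                        × Relaxed D₀ p (array s 1)

    relax-correct : ∀ D₀ u v s → scalar s 4 ≡ toℕ v →
                    RelaxState D₀ (toℕ u) (n * toℕ u + toℕ v) s →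
                    RelaxState D₀ (toℕ u) (suc (n * toℕ u + toℕ v)) (run relax s)
    relax-correct D₀ u v s s4 (s3 , s5 , s0 , R) =
      finish (run (when (read 0 (var 5)) improve) s) (when-rule P (read 0 (var 5)) improve s
        (λ entry≢0 → when-rule P difference shorten s
          (λ diff≢0 → update (adjacent entry≢0) (m∸n≢0⇒n<m diff≢0))
          (λ diff≡0 → skipped (λ _ → no-improvement (m∸n≡0⇒m≤n diff≡0))))
        (λ entry≡0 → skipped (λ e → contradiction entry≡0 (entry-nonzero e))))
      where
      difference = read 1 (var 4) ⊖ (read 1 (var 3) ⊕ lit 1)
      shorten improve : Command
      shorten = put 1 (var 4) (read 1 (var 3) ⊕ lit 1)
      improve = when difference shorten
      p = n * toℕ u + toℕ v
      D = array s 1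
      P : State → Set
      P r = scalar r 3 ≡ toℕ u × scalar r 5 ≡ p × array r 0 ≡ matrix G
          × Relaxed D₀ (suc p) (array r 1)
      entry : array s 0 (scalar s 5) ≡ (if adj G u v then 1 else 0)
      entry = trans (cong-app₂ s0 s5) (matrix-entry G u v)
      if-true : ∀ {b} → T b → (if b then 1 else 0) ≢ 0
      if-true {true} _ ()
      if-false : ∀ {b} → (if b then 1 else 0) ≢ 0 → T b
      if-false {true} _ = _
      if-false {false} ≢0 = ≢0 refl
      entry-nonzero : Adj G u v → array s 0 (scalar s 5) ≢ 0
      entry-nonzero e eq = if-true e (trans (sym entry) eq)
      adjacent : array s 0 (scalar s 5) ≢ 0 → Adj G u v
      adjacent ≢0 = if-false (λ eq → ≢0 (trans entry eq))
      skipped : (Adj G u v → D (toℕ v) ≤ suc (D₀ (toℕ u))) → P s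
      skipped new = s3 , s5 , s0 , relaxed-skip R new
      no-improvement : D (scalar s 4) ≤ D (scalar s 3) + 1 → D (toℕ v) ≤ suc (D₀ (toℕ u))
      no-improvement le = ≤-trans (subst₂ (λ x y → D x ≤ D y + 1) s4 s3 le) (relaxed-new R (toℕ u))
      update : Adj G u v → D (scalar s 3) + 1 < D (scalar s 4) → P (run shorten s)
      update e shorter = s3 , s5 , s0 ,
        subst₂ (λ x y → Relaxed D₀ (suc p) (D [ x ↦ D y + 1 ])) (sym s4) (sym s3)
          (relaxed-skip (relaxed-update R e (subst₂ (λ x y → D x + 1 < D y) s3 s4 shorter))
            (λ _ → subst (_≤ suc (D₀ (toℕ u))) (sym (update-same D (toℕ v)))
                     (relaxed-new R (toℕ u))))
      finish : ∀ r → P r → RelaxState D₀ (toℕ u) (suc p) (run (set 5 (var 5 ⊕ lit 1)) r)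
      finish r (r3 , r5 , r0 , R′) = r3 , trans (+-comm _ 1) (cong suc r5) , r0 , R′

    round-correct : ∀ s → scalar s 0 ≡ n → array s 0 ≡ matrix G → Sound (array s 1) →
                    array (run round s) 0 ≡ matrix G
                    × Relaxed (array s 1) (n * n) (array (run round s) 1)
    round-correct s s0≡n s0 snd with
      for-rule Outer {3} {0} {for 4 0 relax} _ _ _ (assignScalar 5 0 s) s0≡n
        (sym (*-zeroʳ n) , s0 , start) outer
      where
      D₀ = array s 1
      -- Variable 5 grows by n per row and thus equals n * i without a multiplication.
      Outer : ℕ → State → Set
      Outer i r = scalar r 5 ≡ n * i × array r 0 ≡ matrix G × Relaxed D₀ (n * i) (array r 1)
      start : Relaxed D₀ (n * 0) D₀
      start .sound = snd
      start .decreasing w = ≤-refl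
      start .relaxed u v e lt = contradiction (subst (n * toℕ u + toℕ v <_) (*-zeroʳ n) lt) λ ()
      outer : ∀ i r → i < n → scalar r 0 ≡ n → scalar r 3 ≡ i → Outer i r →
              Outer (suc i) (step 3 (for 4 0 relax) r)
      outer i r i<n r0 r3 (r5 , rm , R)
        with for-rule (λ j → RelaxState D₀ i (n * i + j)) {4} {0} {relax} _ _ _ r r0
               (r3 , trans r5 (sym (+-identityʳ _)) , rm ,
                subst (λ p → Relaxed D₀ p (array r 1)) (sym (+-identityʳ _)) R)
               inner
        where
        inner : ∀ j q → j < n → scalar q 0 ≡ n → scalar q 4 ≡ j → RelaxState D₀ i (n * i + j) q →
                RelaxState D₀ i (n * i + suc j) (step 4 relax q)
        inner j q j<n _ q4 I with relax-correct D₀ (fromℕ< i<n) (fromℕ< j<n) q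
        ... | correct rewrite toℕ-fromℕ< i<n | toℕ-fromℕ< j<n | +-suc (n * i) j = correct q4 I
      ... | _ , f5 , fm , R′ = trans f5 (sym n*1+i) , fm ,
              subst (λ p → Relaxed D₀ p (array (run (for 4 0 relax) r) 1)) (sym n*1+i) R′
        where
        n*1+i : n * suc i ≡ n * i + n
        n*1+i = trans (*-suc n i) (+-comm n (n * i))
    ... | _ , fm , R = fm , R

    -- This is the Bellman-Ford method: after r rounds an entry is at most the length of any walk to
    -- the source with at most r edges. Soundness gives the other inequality.
    distances-correct : ∀ s → scalar s 0 ≡ n → array s 0 ≡ matrix G → scalar s 1 ≡ toℕ src →
                        ∀ w → array (run distances s) 1 (toℕ w) ≡ d w src
    distances-correct s s0≡n s0 s1 w =
      ≤-antisym D≤d (d≤D (proj₁ (proj₂ final) w))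
      where
      fill : Command
      fill = put 1 (var 4) (var 0)
      Filled : ℕ → State → Set
      Filled i r = ∀ (w : Vertex G) → toℕ w < i → array r 1 (toℕ w) ≡ n
      filled : Filled n (run (for 4 0 fill) s)
      filled = for-rule Filled {4} {0} {fill} _ _ _ s s0≡n (λ _ ()) next
        where
        next : ∀ i r → i < n → scalar r 0 ≡ n → scalar r 4 ≡ i → Filled i r →
               Filled (suc i) (step 4 fill r)
        next i r _ r0 refl F w w<1+i with scalar r 4 ≟ toℕ w
        ... | yes i≡w = trans (cong (array r 1 [ scalar r 4 ↦ scalar r 0 ]) (sym i≡w))
                              (trans (update-same (array r 1) (scalar r 4)) r0)
        ... | no i≢w  = trans (update-other (array r 1) i≢w)
                              (F w (≤∧≢⇒< (s≤s⁻¹ w<1+i) (λ eq → i≢w (sym eq))))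
      s₁ s₂ : State
      s₁ = run (for 4 0 fill) s
      s₂ = run (put 1 (var 1) (lit 0)) s₁
      s₁1 : scalar s₁ 1 ≡ toℕ src
      s₁1 = trans (keeps (for 4 0 fill) {1} _ s) s1
      s₂0 : scalar s₂ 0 ≡ n
      s₂0 = trans (keeps (for 4 0 fill) {0} _ s) s0≡n
      Reached : ℕ → State → Set
      Reached r q = array q 0 ≡ matrix G × Sound (array q 1)
                  × (∀ {w k} → Walk G k w src → k ≤ r → array q 1 (toℕ w) ≤ k)
      D₂src : array s₂ 1 (toℕ src) ≡ 0
      D₂src = trans (cong (array s₂ 1) (sym s₁1)) (update-same (array s₁ 1) (scalar s₁ 1))
      start : Reached 0 (assignScalar 2 0 s₂)
      start = trans (keepsArray (for 4 0 fill) {0} _ s) s0 , snd , λ { [] z≤n → ≤-reflexive D₂src }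
        where
        snd : Sound (array s₂ 1)
        snd w with src Fin.≟ w
        ... | yes refl = inj₂ (subst (λ k → Walk G k src src) (sym D₂src) [])
        ... | no src≢w = inj₁ (≤-reflexive (sym (trans
                (update-other (array s₁ 1) (λ eq → src≢w (toℕ-injective (trans (sym s₁1) eq))))
                (filled w (toℕ<n w)))))
      next : ∀ i r → i < n → scalar r 0 ≡ n → scalar r 2 ≡ i → Reached i r →
             Reached (suc i) (step 2 round r)
      next i r _ r0 _ (rm , snd , reach) with round-correct r r0 rm snd
      ... | m′ , R = m′ , R .sound , reach′
        where
        reach′ : ∀ {w k} → Walk G k w src → k ≤ suc i → array (run round r) 1 (toℕ w) ≤ k
        reach′ [] _ = ≤-trans (R .decreasing _) (reach [] z≤n)
        -- The walk runs towards the source, so its first edge is relaxed in reverse and last.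
        reach′ (e ∷ p) (s≤s k≤i) =
          ≤-trans (R .relaxed _ _ (adj-sym G e) (index< {n} _ _)) (s≤s (reach p k≤i))
      final : Reached n (run distances s)
      final = for-rule Reached {2} {0} {round} _ _ _ s₂ s₂0 start next
      D : ℕ → ℕ
      D = array (run distances s) 1
      D≤d : D (toℕ w) ≤ d w src
      D≤d = proj₂ (proj₂ final) (geodesic w src) (<⇒≤ (d<order w src))
      d≤D : n ≤ D (toℕ w) ⊎ Walk G (D (toℕ w)) w src → d w src ≤ D (toℕ w)
      d≤D (inj₁ n≤D) = ≤-trans (<⇒≤ (d<order w src)) n≤D
      d≤D (inj₂ p)   = d≤ p

  farthest-correct : ∀ s → scalar s 0 ≡ n → (f : Vertex G) → scalar s 1 ≡ toℕ f →
                     ∃[ f′ ] scalar (run farthest s) 1 ≡ toℕ f′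
                     × (∀ (w : Vertex G) → array s 1 (toℕ w) ≤ array s 1 (toℕ f′))
  farthest-correct s s0≡n f s1
    with for-rule Far {4} {0} {body} _ _ _ s s0≡n (refl , f , s1 , λ _ ()) next
    where
    body : Command
    body = when (read 1 (var 4) ⊖ read 1 (var 1)) (set 1 (var 4))
    D : ℕ → ℕ
    D = array s 1
    Far : ℕ → State → Set
    Far i r = array r 1 ≡ D × Σ[ f ∈ Vertex G ] scalar r 1 ≡ toℕ f
            × (∀ (w : Vertex G) → toℕ w < i → D (toℕ w) ≤ D (toℕ f))
    next : ∀ i r → i < n → scalar r 0 ≡ n → scalar r 4 ≡ i → Far i r → Far (suc i) (step 4 body r)
    next i r i<n _ r4 (rD , f , r1 , far) =
      when-rule (λ q → Far (suc i) q) (read 1 (var 4) ⊖ read 1 (var 1)) (set 1 (var 4)) r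
        (λ diff≢0 → rD , fromℕ< i<n , trans r4 (sym (toℕ-fromℕ< i<n)) , λ w w<1+i →
          let f<i : D (toℕ f) < D i
              f<i = subst₂ _<_ (cong-app₂ rD r1) (cong-app₂ rD r4)
                      (m∸n≢0⇒n<m diff≢0)
          in subst (λ x → D (toℕ w) ≤ D x) (sym (toℕ-fromℕ< i<n))
                   (extend (<⇒≤ f<i) ≤-refl w w<1+i))
        (λ diff≡0 → rD , f , r1 , extend ≤-refl
          (subst₂ _≤_ (cong-app₂ rD r4) (cong-app₂ rD r1) (m∸n≡0⇒m≤n diff≡0)))
      where
      extend : ∀ {y} → D (toℕ f) ≤ y → D i ≤ y → ∀ w → toℕ w < suc i → D (toℕ w) ≤ y
      extend f≤ i≤ w w<1+i with m<1+n⇒m<n∨m≡n w<1+i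
      ... | inj₁ w<i  = ≤-trans (far w w<i) f≤
      ... | inj₂ refl = i≤
  ... | _ , f′ , f′≡ , far = f′ , f′≡ , λ w → far w (toℕ<n w)

  record Swept (src far : Vertex G) (s : State) : Set where
    field
      far-scalar : scalar s 1 ≡ toℕ far
      distance≡  : ∀ w → array s 1 (toℕ w) ≡ d w src
      farthest≥  : ∀ w → d w src ≤ d far src

  sweep-correct : ∀ s → scalar s 0 ≡ n → array s 0 ≡ matrix G → ∀ src → scalar s 1 ≡ toℕ src →
                  ∃[ far ] Swept src far (run sweep s)
  sweep-correct s s0≡n s0 src s1
    with farthest-correct (run distances s) (trans (keeps distances {0} _ s) s0≡n) src
           (trans (keeps distances {1} _ s) s1)
  ... | far , far≡ , max = far , record
    { far-scalar = far≡
    ; distance≡  = λ w → trans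
        (cong (λ f → f (toℕ w)) (keepsArray farthest {1} _ (run distances s))) (exact w)
    ; farthest≥  = λ w → subst₂ _≤_ (exact w) (exact far) (max w)
    }
    where exact = distances-correct src s s0≡n s0 s1

-- Later vertices of the same distance overwrite earlier ones, so the invariant promises only some
-- vertex with the distance of `w`.
layers-correct : ∀ {n} s → scalar s 0 ≡ n → ∀ {w} → w < n →
                 ∃[ z ] z < n × array (run layers s) 2 (array s 1 w) ≡ z × array s 1 z ≡ array s 1 w
layers-correct {n} s s0≡n {w} w<n =
  proj₂ (for-rule Represented {4} {0} {body} _ _ _ s s0≡n (refl , λ _ ()) next) w w<n
  where
  body : Command
  body = put 2 (read 1 (var 4)) (var 4)
  D : ℕ → ℕ
  D = array s 1
  Represented : ℕ → State → Set
  Represented i r = array r 1 ≡ D ×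
    (∀ w → w < i → ∃[ z ] z < n × array r 2 (D w) ≡ z × D z ≡ D w)
  next : ∀ i r → i < n → scalar r 0 ≡ n → scalar r 4 ≡ i → Represented i r →
         Represented (suc i) (step 4 body r)
  next i r i<n _ r4 (rD , rep) = rD , rep′
    where
    key : array r 1 (scalar r 4) ≡ D i
    key = cong-app₂ rD r4
    rep′ : ∀ w → w < suc i → ∃[ z ] z < n × array (step 4 body r) 2 (D w) ≡ z × D z ≡ D w
    rep′ w w<1+i with D i ≟ D w
    ... | yes Di≡Dw = i , i<n , trans (cong (array (step 4 body r) 2) (sym (trans key Di≡Dw)))
                                      (trans (update-same (array r 2) (array r 1 (scalar r 4))) r4) , Di≡Dw
    ... | no Di≢Dw with m<1+n⇒m<n∨m≡n w<1+i
    ...   | inj₂ refl = contradiction refl Di≢Dw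
    ...   | inj₁ w<i with rep w w<i
    ...     | z , z<n , Aw≡z , Dz≡Dw = z , z<n ,
              trans (update-other (array r 2) (λ eq → Di≢Dw (trans (sym key) eq))) Aw≡z , Dz≡Dw

-- `M` is the least number whose square exceeds `E`, that is ⌊√E⌋ + 1. Each iteration advances until
-- this is reached, and n iterations suffice because E < n ≤ n².
squares-correct : ∀ {n} s E → scalar s 0 ≡ n → array s 1 (scalar s 1) ≡ E →
                  scalar s 6 ≡ 0 → scalar s 7 ≡ 0 → E < n →
                  let M = scalar (run squares s) 6 in
                  scalar (run squares s) 7 ≡ M * M × E < M * M × pred M * pred M ≤ E
squares-correct {n} s E s0≡n sE s6 s7 E<n
  with for-rule Squares {4} {0} {body} _ _ _ s s0≡n
         (sE , trans s7 (cong (λ x → x * x) (sym s6)) , inj₁ z≤n ,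
          subst (λ x → pred x * pred x ≤ E) (sym s6) z≤n)
         next
  where
  test = read 1 (var 1) ⊕ lit 1 ⊖ var 7
  advance = set 7 (var 7 ⊕ (var 6 ⊕ var 6 ⊕ lit 1)) ⨟ set 6 (var 6 ⊕ lit 1)
  body : Command
  body = when test advance
  Squares : ℕ → State → Set
  Squares i r = array r 1 (scalar r 1) ≡ E
              × scalar r 7 ≡ scalar r 6 * scalar r 6
              × (i ≤ scalar r 6 ⊎ E < scalar r 7)
              × pred (scalar r 6) * pred (scalar r 6) ≤ E
  next : ∀ i r → i < n → scalar r 0 ≡ n → scalar r 4 ≡ i → Squares i r →
         Squares (suc i) (step 4 body r)
  next i r _ _ _ (rE , r7 , far , low) = when-rule (Squares (suc i)) test advance r more done
    where
    ρ = scalar r 6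
    square+ : ∀ ρ → ρ * ρ + (ρ + ρ + 1) ≡ (ρ + 1) * (ρ + 1)
    square+ = solve-∀
    more : ⟦ test ⟧ r ≢ 0 → Squares (suc i) (run advance r)
    more ≢0 = rE , trans (cong (_+ (ρ + ρ + 1)) r7) (square+ ρ) , inj₁ (reached far) ,
              subst (λ x → pred x * pred x ≤ E) (+-comm 1 ρ) (subst (_≤ E) r7 q≤E)
      where
      q≤E : scalar r 7 ≤ E
      q≤E = s≤s⁻¹ (subst (scalar r 7 <_) (trans (+-comm _ 1) (cong suc rE)) (m∸n≢0⇒n<m ≢0))
      reached : i ≤ ρ ⊎ E < scalar r 7 → suc i ≤ ρ + 1
      reached (inj₁ i≤ρ) = subst (suc i ≤_) (+-comm 1 ρ) (s≤s i≤ρ)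
      reached (inj₂ E<q) = contradiction q≤E (<⇒≱ E<q)
    done : ⟦ test ⟧ r ≡ 0 → Squares (suc i) r
    done ≡0 = rE , r7 ,
      inj₂ (subst (_≤ scalar r 7) (trans (+-comm _ 1) (cong suc rE)) (m∸n≡0⇒m≤n ≡0)) , low
... | _ , q≡ , inj₂ E<q , low = q≡ , subst (E <_) q≡ E<q , low
... | _ , q≡ , inj₁ n≤M , low = q≡ , ≤-trans E<n (≤-trans (n≤n*n n) (*-mono-≤ n≤M n≤M)) , low

-- The minimum of `E` and `x`, in the form in which `emitNext` computes it.
clamp : ℕ → ℕ → ℕ
clamp E x = E ∸ (E ∸ x)

emitted : ℕ → ℕ → (ℕ → ℕ) → ℕ → ℕ
emitted E M A i = A (clamp E (ρ * ρ + ρ))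
  where ρ = M ∸ suc i

emit-correct : ∀ C {n} s M E → scalar s 0 ≡ n → array s 1 (scalar s 1) ≡ E →
               scalar s 6 ≡ M → scalar s 7 ≡ M * M →
               scalar (run (emit C) s) 8 ≡ M + C
               × (∀ i → i < C + n → array (run (emit C) s) 0 i ≡ emitted E M (array s 2) i)
emit-correct C {n} s M E s0≡n sE s6 s7 =
  trans (keeps (for 4 C emitNext) {8} _ s₁) (cong (_+ C) s6) ,
  proj₂ (proj₂ (proj₂ (proj₂ (for-rule Emitted {4} {C} {emitNext} _ _ _ s₁ s0≡n
    (sE , refl , s6 , s7 , λ _ ()) next))))
  where
  s₁ = run (set 8 (var 6 ⊕ lit C)) s
  A = array s 2
  Emitted : ℕ → State → Set
  Emitted i r = array r 1 (scalar r 1) ≡ E × array r 2 ≡ A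
              × scalar r 6 ≡ M ∸ i × scalar r 7 ≡ (M ∸ i) * (M ∸ i)
              × (∀ k → k < i → array r 0 k ≡ emitted E M A k)
  -- At ρ = 0 truncation keeps the square at 0, as the extra rounds require.
  square- : ∀ ρ → ρ * ρ ∸ (pred ρ + pred ρ + 1) ≡ pred ρ * pred ρ
  square- zero = refl
  square- (suc ρ) = trans (cong (_∸ (ρ + ρ + 1)) (expand ρ)) (m+n∸n≡m (ρ * ρ) (ρ + ρ + 1))
    where
    expand : ∀ ρ → suc ρ * suc ρ ≡ ρ * ρ + (ρ + ρ + 1)
    expand = solve-∀
  next : ∀ i r → i < C + n → scalar r 0 ≡ n → scalar r 4 ≡ i → Emitted i r →
         Emitted (suc i) (step 4 emitNext r)
  next i r i< _ r4 (rE , rA , r6 , r7 , out) = rE , rA , ρ≡ , q≡ , out′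
    where
    ρ = M ∸ suc i
    ρ≡ : scalar r 6 ∸ 1 ≡ ρ
    ρ≡ = trans (cong (_∸ 1) r6) (trans (∸-+-assoc M i 1) (cong (M ∸_) (+-comm i 1)))
    pred≡ : pred (M ∸ i) ≡ ρ
    pred≡ = pred[m∸n]≡m∸[1+n] M i
    q≡ : scalar r 7 ∸ ((scalar r 6 ∸ 1) + (scalar r 6 ∸ 1) + 1) ≡ ρ * ρ
    q≡ = trans (cong₂ (λ q x → q ∸ (x + x + 1)) r7 (trans ρ≡ (sym pred≡)))
               (trans (square- (M ∸ i)) (cong (λ x → x * x) pred≡))
    value : ⟦ read 2 (read 1 (var 1) ⊖ (read 1 (var 1) ⊖ (var 7 ⊕ var 6))) ⟧
            (run (set 6 (var 6 ⊖ lit 1) ⨟ set 7 (var 7 ⊖ (var 6 ⊕ var 6 ⊕ lit 1))) r)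
            ≡ emitted E M A i
    value = cong-app₂ rA (cong₂ clamp rE (cong₂ _+_ q≡ ρ≡))
    out′ : ∀ k → k < suc i → array (step 4 emitNext r) 0 k ≡ emitted E M A k
    out′ k k<1+i with m<1+n⇒m<n∨m≡n k<1+i
    ... | inj₁ k<i  = trans (update-other (array r 0) (λ eq → <⇒≢ k<i (sym (trans (sym r4) eq))))
                            (out k k<i)
    ... | inj₂ refl = trans (cong (array (step 4 emitNext r) 0) (sym r4))
                            (trans (update-same (array r 0) (scalar r 4)) value)

-- The approximation factor

open import Data.Integer.Base using (+_; +[1+_])

root-≤ : ∀ {m n} → m * m ≤ n → m ≤ root n
root-≤ {m} {n} m²≤n = s≤s⁻¹ (square-cancel-< (≤-<-trans m²≤n ([1+root]²> n)))

ratio : ℕ → ℕ → ℚ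
ratio C d = + C ℚ./ suc (root d)

-- Normalised rationals involve a gcd that does not compute for variables; all comparisons are
-- therefore made on unnormalised fractions.
ratio≃ : ∀ C d → ℚ.toℚᵘ (ratio C d) ℚᵘ.≃ mkℚᵘ (+ C) (root d)
ratio≃ C d = ℚ.toℚᵘ-fromℚᵘ (mkℚᵘ (+ C) (root d))

fromℕ≃ : ∀ n → ℚ.toℚᵘ (fromℕ n) ℚᵘ.≃ mkℚᵘ (+ n) 0
fromℕ≃ n = ℚ.toℚᵘ-fromℚᵘ (mkℚᵘ (+ n) 0)

+*+-mono-≤ : ∀ {a b c d} → a * b ≤ c * d → + a ℤ.* + b ℤ.≤ + c ℤ.* + d
+*+-mono-≤ {a} {b} {c} {d} le = subst₂ ℤ._≤_ (ℤ.pos-* a b) (ℤ.pos-* c d) (ℤ.+≤+ le)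

+*+-mono-< : ∀ {a b c d} → a * b < c * d → + a ℤ.* + b ℤ.< + c ℤ.* + d
+*+-mono-< {a} {b} {c} {d} lt = subst₂ ℤ._<_ (ℤ.pos-* a b) (ℤ.pos-* c d) (ℤ.+<+ lt)

ratio-nonneg : ∀ C d → 0ℚ ℚ.≤ ratio C d
ratio-nonneg C d = ℚ.toℚᵘ-cancel-≤ (ℚᵘ.≤-respʳ-≃ (ℚᵘ.≃-sym (ratio≃ C d))
  (ℚᵘ.*≤* (+*+-mono-≤ {0} {suc (root d)} {C} {1} z≤n)))

ratio→0 : ∀ C → TendsToZero (ratio C)
ratio→0 C δ 0<δ = below δ (ℚ.positive 0<δ)
  where
  below : ∀ δ → ℚ.Positive δ → ∃[ N ] (∀ d → N ≤ d → ℚ.∣ ratio C d ∣ ℚ.< δ)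
  -- Here δ = (1 + p)/(1 + q) is at least 1/(1 + q). If d ≥ K², the root is at least K = C(1 + q),
  -- and the ratio is below 1/(1 + q).
  below (mkℚ +[1+ p ] q c) _ = K * K , λ d K²≤d →
    subst (ℚ._< mkℚ +[1+ p ] q c) (sym (ℚ.0≤p⇒∣p∣≡p (ratio-nonneg C d)))
      (ℚ.toℚᵘ-cancel-< (ℚᵘ.<-respˡ-≃ (ℚᵘ.≃-sym (ratio≃ C d))
        (ℚᵘ.*<* (+*+-mono-< {C} {suc q} {suc p} {suc (root d)}
          (≤-trans (s≤s (root-≤ {K} K²≤d)) (m≤n*m (suc (root d)) (suc p)))))))
    where K = C * suc q

-- Since b is at least 1 + `root d`, the additive error `C` is at most `ratio C d` times b.
approximation : ∀ {C b d m} → m ≤ b + C → root d < b →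
                fromℕ m ℚ.≤ (1ℚ ℚ.+ ratio C d) ℚ.* fromℕ b
approximation {C} {b} {d} {m} m≤ r<b = ℚ.toℚᵘ-cancel-≤ (begin
  ℚ.toℚᵘ (fromℕ m)                              ≃⟨ fromℕ≃ m ⟩
  mkℚᵘ (+ m) 0                                  ≤⟨ ℚᵘ.*≤* core ⟩
  (ℚᵘ.1ℚᵘ ℚᵘ.+ mkℚᵘ (+ C) r) ℚᵘ.* mkℚᵘ (+ b) 0
    ≃⟨ ℚᵘ.*-cong (ℚᵘ.+-cong (ℚᵘ.≃-refl {ℚᵘ.1ℚᵘ}) (ratio≃ C d)) (fromℕ≃ b) ⟨
  (ℚᵘ.1ℚᵘ ℚᵘ.+ ℚ.toℚᵘ (ratio C d)) ℚᵘ.* ℚ.toℚᵘ (fromℕ b)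
    ≃⟨ ℚᵘ.*-congʳ (ℚ.toℚᵘ-homo-+ 1ℚ (ratio C d)) ⟨
  ℚ.toℚᵘ (1ℚ ℚ.+ ratio C d) ℚᵘ.* ℚ.toℚᵘ (fromℕ b)
    ≃⟨ ℚ.toℚᵘ-homo-* (1ℚ ℚ.+ ratio C d) (fromℕ b) ⟨
  ℚ.toℚᵘ ((1ℚ ℚ.+ ratio C d) ℚ.* fromℕ b)       ∎)
  where
  open ℚᵘ.≤-Reasoning
  r = root d
  cross : m * suc r ≤ (suc r + C) * b
  cross = ≤-trans (*-monoˡ-≤ (suc r) m≤) (≤-trans (≤-reflexive (*-distribʳ-+ (suc r) b C))
    (≤-trans (+-monoʳ-≤ (b * suc r) (*-monoʳ-≤ C r<b))
      (≤-reflexive (trans (cong (_+ C * b) (*-comm b (suc r))) (sym (*-distribʳ-+ b (suc r) C))))))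
  core : + m ℤ.* ℚᵘ.↧ ((ℚᵘ.1ℚᵘ ℚᵘ.+ mkℚᵘ (+ C) r) ℚᵘ.* mkℚᵘ (+ b) 0)
         ℤ.≤ ℚᵘ.↥ ((ℚᵘ.1ℚᵘ ℚᵘ.+ mkℚᵘ (+ C) r) ℚᵘ.* mkℚᵘ (+ b) 0) ℤ.* + 1
  core = subst₂ ℤ._≤_
    (trans (ℤ.pos-* m (suc r))
      (cong (λ x → + m ℤ.* + suc x) (sym (trans (*-identityʳ (r + 0)) (+-identityʳ r)))))
    (trans (ℤ.pos-* (suc r + C) b) (trans (cong (ℤ._* + b) num) (sym (ℤ.*-identityʳ _))))
    (ℤ.+≤+ cross)
    where
    num : + (suc r + C) ≡ ℚᵘ.↥ (ℚᵘ.1ℚᵘ ℚᵘ.+ mkℚᵘ (+ C) r)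
    num = trans (ℤ.pos-+ (suc r) C)
            (cong₂ ℤ._+_ (sym (ℤ.*-identityˡ (+ suc r))) (sym (ℤ.*-identityʳ (+ C))))

algorithm-halts : ∀ C G → ∃[ t ] (input G ⊢ algorithm C ⇓[ t ]
                    assignScalar 0 (scalar (run (main C) (input G)) 8) (run (main C) (input G)))
                    × t ≤ timeBound (main C) (order G) + 2
algorithm-halts C G =
  let (t , h , t≤) = halts (main C) _ (input G) in t + 2 , ⇓seq h ⇓assign , +-monoˡ-≤ 2 t≤

algorithm-polynomial : ∀ C → PolynomialTime (algorithm C)
algorithm-polynomial C =
  let (c , k , bound) = poly-+ (timeBound-polynomial (main C)) (poly-const 2) in
  c , k , λ G → let (t , h , t≤) = algorithm-halts C G in
  t , _ , h , ≤-trans t≤ (≤-trans (bound (order G))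
    -- `inputSize G` is 1 + n², which is at least 1 + n.
    (*-monoʳ-≤ c (^-monoˡ-≤ k (s≤s (n≤n*n (order G))))))

∣-∣≤ : ∀ {m n k} → m ≤ n + k → n ≤ m + k → ∣ m - n ∣ ≤ k
∣-∣≤ {m} {n} m≤n+k n≤m+k with ∣m-n∣≡[m∸n]∨[n∸m] m n
... | inj₁ eq = subst (_≤ _) (sym eq) (m≤n+o⇒m∸n≤o m n m≤n+k)
... | inj₂ eq = subst (_≤ _) (sym eq) (m≤n+o⇒m∸n≤o n m n≤m+k)

clamp≤ : ∀ E x → clamp E x ≤ E
clamp≤ E x = m∸n≤m E (E ∸ x)

-- With ρ = `root j`, the number `j` lies between ρ² and ρ² + 2ρ, hence within ρ of ρ² + ρ. If that
-- level exceeds `E`, then j ≤ E ≤ ρ² + ρ ≤ j + ρ.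
clamp-close : ∀ {E} j → j ≤ E → ∣ clamp E (root j * root j + root j) - j ∣ ≤ root j
clamp-close {E} j j≤E with ≤-total (root j * root j + root j) E
... | inj₁ x≤E rewrite m∸[m∸n]≡n x≤E =
  ∣-∣≤ (+-monoˡ-≤ (root j) (root²≤ j))
       (s≤s⁻¹ (subst (j <_) (trans (square-suc (root j))
         (cong suc (sym (+-assoc _ (root j) (root j))))) ([1+root]²> j)))
... | inj₂ E≤x rewrite m≤n⇒m∸n≡0 E≤x =
  ∣-∣≤ (≤-trans E≤x (+-monoˡ-≤ (root j) (root²≤ j))) (≤-trans j≤E (m≤m+n E (root j)))

-- From the final state to a burning schedule

module Output (G : Graph) (connected : Connected G) where
  open Metric G connected
  open SweepCorrect G connected

  -- This is all that the burning argument needs to know about the program.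
  record Result (C : ℕ) (o : Vertex G) (s : State) : Set where
    field
      u f   : Vertex G
      M     : ℕ
      A     : ℕ → ℕ
      u-far : ∀ w → d w o ≤ d u o
      f-far : ∀ w → d w u ≤ d f u
      M-big : d f u < M * M
      M-min : pred M * pred M ≤ d f u
      representative : ∀ w → ∃[ z ] A (d w u) ≡ toℕ z × d z u ≡ d w u
      rounds : scalar s 8 ≡ M + C
      output : ∀ i → i < C + n → array s 0 i ≡ emitted (d f u) M A i

  module _ {C : ℕ} {o : Vertex G} {s₁ s₂ s₃ s₄ s₅ : State} (o≡0 : toℕ o ≡ 0)
           (sweep₁ : Ran sweep (input G) s₁) (sweep₂ : Ran sweep s₁ s₂)
           (layers₃ : Ran layers s₂ s₃) (squares₄ : Ran squares s₃ s₄)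
           (emit₅ : Ran (emit C) s₄ s₅) where

    first : ∃[ u ] Swept o u s₁
    first = ran-rule sweep₁ (λ s → ∃[ u ] Swept o u s) (sweep-correct (input G) refl refl o (sym o≡0))

    second : ∃[ f ] Swept (proj₁ first) f s₂
    second = ran-rule sweep₂ (λ s → ∃[ f ] Swept (proj₁ first) f s)
      (sweep-correct s₁ (ran-keeps sweep₁ {0} _) (ran-keepsArray sweep₁ {0} _)
        (proj₁ first) (Swept.far-scalar (proj₂ first)))

    private
      u = proj₁ first
      f = proj₁ second
      S₂ = proj₂ second

    s₂0 : scalar s₂ 0 ≡ n
    s₂0 = trans (ran-keeps sweep₂ {0} _) (ran-keeps sweep₁ {0} _)

    s₃0 : scalar s₃ 0 ≡ n
    s₃0 = trans (ran-keeps layers₃ {0} _) s₂0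

    s₃E : array s₃ 1 (scalar s₃ 1) ≡ d f u
    s₃E = trans (cong-app₂ (ran-keepsArray layers₃ {1} _)
                           (trans (ran-keeps layers₃ {1} _) (Swept.far-scalar S₂)))
                (Swept.distance≡ S₂ f)

    s₄E : array s₄ 1 (scalar s₄ 1) ≡ d f u
    s₄E = trans (cong-app₂ (ran-keepsArray squares₄ {1} _) (ran-keeps squares₄ {1} _)) s₃E

    still-zero : ∀ x → Keeps x sweep → Keeps x layers → scalar (input G) x ≡ 0 → scalar s₃ x ≡ 0
    still-zero x ks kl i0 =
      trans (ran-keeps layers₃ kl) (trans (ran-keeps sweep₂ ks) (trans (ran-keeps sweep₁ ks) i0))

    squared : scalar s₄ 7 ≡ scalar s₄ 6 * scalar s₄ 6
            × d f u < scalar s₄ 6 * scalar s₄ 6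
            × pred (scalar s₄ 6) * pred (scalar s₄ 6) ≤ d f u
    squared = ran-rule squares₄
      (λ s → scalar s 7 ≡ scalar s 6 * scalar s 6 × d f u < scalar s 6 * scalar s 6
           × pred (scalar s 6) * pred (scalar s 6) ≤ d f u)
      (squares-correct s₃ (d f u) s₃0 s₃E
        (still-zero 6 _ _ refl) (still-zero 7 _ _ refl) (d<order f u))

    emits : scalar s₅ 8 ≡ scalar s₄ 6 + C
          × (∀ i → i < C + n → array s₅ 0 i ≡ emitted (d f u) (scalar s₄ 6) (array s₄ 2) i)
    emits = ran-rule emit₅
      (λ s → scalar s 8 ≡ scalar s₄ 6 + C
           × (∀ i → i < C + n → array s 0 i ≡ emitted (d f u) (scalar s₄ 6) (array s₄ 2) i))
      (emit-correct C s₄ (scalar s₄ 6) (d f u) (trans (ran-keeps squares₄ {0} _) s₃0) s₄E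
        refl (proj₁ squared))

    represented : ∀ w → ∃[ z ] array s₄ 2 (d w u) ≡ toℕ z × d z u ≡ d w u
    represented w =
      let (z , z<n , Aw≡z , Dz≡Dw) = ran-rule layers₃
            (λ s → ∃[ z ] z < n × array s 2 (array s₂ 1 (toℕ w)) ≡ z
                        × array s₂ 1 z ≡ array s₂ 1 (toℕ w))
            (layers-correct s₂ s₂0 (toℕ<n w))
      in fromℕ< z<n ,
         trans (cong-app₂ (ran-keepsArray squares₄ {2} _) (sym (Swept.distance≡ S₂ w)))
               (trans Aw≡z (sym (toℕ-fromℕ< z<n))) ,
         trans (sym (Swept.distance≡ S₂ (fromℕ< z<n)))
               (trans (cong (array s₂ 1) (toℕ-fromℕ< z<n)) (trans Dz≡Dw (Swept.distance≡ S₂ w)))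

    result : Result C o s₅
    result = record
      { u = u ; f = f ; M = scalar s₄ 6 ; A = array s₄ 2
      ; u-far = Swept.farthest≥ (proj₂ first)
      ; f-far = Swept.farthest≥ S₂
      ; M-big = proj₁ (proj₂ squared)
      ; M-min = proj₂ (proj₂ squared)
      ; representative = represented
      ; rounds = proj₁ emits
      ; output = proj₂ emits
      }

  module _ {C : ℕ} {o : Vertex G} {s : State} (res : Result C o s)
           (thin : ∀ w z → d w z ≤ ∣ d w (Result.u res) - d z (Result.u res) ∣ + C) where
    open Result res

    E : ℕ
    E = d f u

    centre : ∀ (i : Fin (M + C)) → ∃[ z ] array s 0 (toℕ i) ≡ toℕ z
             × d z u ≡ clamp E ((M ∸ suc (toℕ i)) * (M ∸ suc (toℕ i)) + (M ∸ suc (toℕ i)))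
    -- Levels are inhabited only up to `E`, which is why the address is cut off there.
    centre i with level f u (clamp≤ E ((M ∸ suc (toℕ i)) * (M ∸ suc (toℕ i)) + (M ∸ suc (toℕ i))))
    ... | w , dwu with representative w
    ...   | z , A≡z , dzu = z , trans (output (toℕ i) i<) (trans (cong A (sym dwu)) A≡z) , trans dzu dwu
      where
      -- M - 1 ≤ (M - 1)² ≤ E < n, so the loop of `emit` gets as far as index M + C - 1.
      M≤n : ∀ M → pred M * pred M ≤ E → M ≤ n
      M≤n zero _ = z≤n
      M≤n (suc M) le = ≤-<-trans (≤-trans (n≤n*n M) le) (d<order f u)
      i< : toℕ i < C + n
      i< = <-≤-trans (toℕ<n i) (≤-trans (+-monoˡ-≤ C (M≤n M M-min)) (≤-reflexive (+-comm n C)))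

    schedule : Schedule G (M + C)
    schedule i = proj₁ (centre i)

    schedule-outputs : ∀ {p t} → input G ⊢ p ⇓[ t ] assignScalar 0 (scalar s 8) s →
                       Outputs p G schedule
    schedule-outputs h = _ , _ , h , rounds , λ i → proj₁ (proj₂ (centre i))

    -- A vertex on level `j` is served by the activator at index M - 1 - ρ, where ρ = `root j`. By
    -- `thin` and `clamp-close` it is within ρ + C of that activator, and exactly ρ + C rounds are
    -- left.
    schedule-burns : Burns G schedule
    schedule-burns v = walk⇒burned {k = d (schedule i) v} i (geodesic (schedule i) v) (begin-strict
      toℕ i + d (schedule i) v   ≤⟨ +-monoʳ-≤ (toℕ i)
                                      (≤-trans (thin (schedule i) v) (+-monoˡ-≤ C close)) ⟩
      toℕ i + (ρ + C)            ≡⟨ +-assoc (toℕ i) ρ C ⟨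
      toℕ i + ρ + C              ≡⟨ cong (λ x → x + ρ + C) i≡ ⟩
      M ∸ suc ρ + ρ + C          <⟨ n<1+n _ ⟩
      suc (M ∸ suc ρ + ρ + C)    ≡⟨ cong (_+ C) (+-suc (M ∸ suc ρ) ρ) ⟨
      M ∸ suc ρ + suc ρ + C      ≡⟨ cong (_+ C) (m∸n+n≡m ρ<M) ⟩
      M + C                      ∎)
      where
      open ≤-Reasoning
      j ρ : ℕ
      j = d v u
      ρ = root j
      ρ<M : ρ < M
      ρ<M = square-cancel-< (≤-<-trans (root²≤ j) (≤-<-trans (f-far v) M-big))
      i<m : M ∸ suc ρ < M + C
      i<m = ≤-trans (∸-monoʳ-< {M} {suc ρ} {0} (s≤s z≤n) ρ<M) (m≤m+n M C)
      i : Fin (M + C)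
      i = fromℕ< i<m
      i≡ : toℕ i ≡ M ∸ suc ρ
      i≡ = toℕ-fromℕ< i<m
      radius : M ∸ suc (toℕ i) ≡ ρ
      radius = trans (cong (λ x → M ∸ suc x) i≡) (trans (sym (pred[m∸n]≡m∸[1+n] M (M ∸ suc ρ)))
                 (cong pred (m∸[m∸n]≡n ρ<M)))
      close : ∣ d (schedule i) u - d v u ∣ ≤ ρ
      close = subst (λ x → ∣ x - j ∣ ≤ ρ)
        (sym (trans (proj₂ (proj₂ (centre i))) (cong (λ r → clamp E (r * r + r)) radius)))
        (clamp-close j (f-far v))

corollary5 : ∀ (L : ℕ) →
    Σ[ p ∈ Program ] Σ[ ε ∈ (ℕ → ℚ) ]
    ( PolynomialTime p
    × (∀ d → 0ℚ ℚ.≤ ε d)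
    × TendsToZero ε
    × (∀ (G : Graph) (d ℓ b : ℕ) →
    Connected G → IsDiameter G d → IsPathLength G ℓ → ℓ ≤ L → IsBurningNumber G b →
    ∃[ m ] Σ[ a ∈ Schedule G m ]
    ( Outputs p G a
    × Burns G a
    × fromℕ m ℚ.≤ (1ℚ ℚ.+ ε d) ℚ.* fromℕ b)))
corollary5 L = algorithm (4 * L) , ratio (4 * L) , algorithm-polynomial (4 * L) ,
  ratio-nonneg (4 * L) , ratio→0 (4 * L) , approximates
  where
  approximates : ∀ (G : Graph) (d ℓ b : ℕ) →
    Connected G → IsDiameter G d → IsPathLength G ℓ → ℓ ≤ L → IsBurningNumber G b →
    ∃[ m ] Σ[ a ∈ Schedule G m ]
    ( Outputs (algorithm (4 * L)) G a
    × Burns G a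
    × fromℕ m ℚ.≤ (1ℚ ℚ.+ ratio (4 * L) d) ℚ.* fromℕ b)
  approximates G diam ℓ b connected ((x , y , xy) , diam-max)
               ((D , _ , bag-max) , _) ℓ≤L ((a , burns) , _) =
    M + 4 * L , schedule res thin ,
    schedule-outputs res thin {algorithm (4 * L)} (proj₁ (proj₂ (algorithm-halts (4 * L) G))) ,
    schedule-burns res thin ,
    approximation {d = diam} (+-monoˡ-≤ (4 * L) M≤b) root<b
    where
    open Metric G connected
    open Output G connected
    -- Variable 1 is initially zero, so the first search starts at vertex 0, which exists because
    -- the diameter is attained by some pair.
    0<n : 0 < order G
    0<n = ≤-<-trans z≤n (toℕ<n x)
    res : Result (4 * L) (fromℕ< 0<n) (run (main (4 * L)) (input G))
    res = result (toℕ-fromℕ< 0<n) ran ran ran ran ran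
    open Result res using (u; f; M; u-far; M-min)
    bounded : ∀ {i x y} → x ∈ PathDecomposition.bag D i →
              y ∈ PathDecomposition.bag D i → d x y ≤ L
    bounded {i} {x} {y} x∈ y∈ =
      ≤-trans (bag-max (d x y) (i , x , y , x∈ , y∈ , proj₂ (distance x y))) ℓ≤L
    thin : ∀ w z → d w z ≤ ∣ d w u - d z u ∣ + 4 * L
    thin = Separators.d≤difference G connected D L bounded u-far
    diam<b² : diam < b * b
    diam<b² = ≤-<-trans (proj₂ xy (d x y) (geodesic x y))
                        (diameter<burning² G connected a burns x y)
    root<b : root diam < b
    root<b = square-cancel-< (≤-<-trans (root²≤ diam) diam<b²)
    -- The eccentricity of `u` is the distance of `f` and `u`, so (M - 1)² ≤ d f u ≤ diam < b².
    M≤b : M ≤ b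
    M≤b = ≤-trans (m≤suc-pred-m M) (square-cancel-< (≤-<-trans
      (≤-trans M-min (diam-max (d f u) (f , u , proj₂ (distance f u)))) diam<b²))
      where
      m≤suc-pred-m : ∀ m → m ≤ suc (pred m)
      m≤suc-pred-m zero = z≤n
      m≤suc-pred-m (suc m) = ≤-refl
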